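{- Let $D$ be a connected C-homogeneous digraph whose underlying undirected graph is not C-homogeneous, which has infinitely many ends, and with $\Delta(D)\cong K_{2,2}$. If the underlying undirected graph of $D$ has connectivity more than one, then $D$ is isomorphic to $M'(2m)$ for some integer $m\geq 2$.
   Context: A digraph consists of a non-empty vertex set and an irreflexive, antisymmetric binary relation (edges). Connectivity and ends refer to the underlying undirected graph; ends are equivalence classes of rays, two rays equivalent if for every finite vertex set $S$ they eventually lie in the same component after deleting $S$. C-homogeneous: every isomorphism between two finite connected induced sub(di)graphs extends to an automorphism. A walk is alternating if consecutive edges on it have opposite orientations; edges on a common alternating walk are reachable from each other, $\Delta_e$ is the digraph formed by the edges reachable from $e$ and their endvertices, and in an edge-transitive digraph $\Delta(D)$ denotes the common isomorphism type of the $\Delta_e$. $K_{2,2}$ is the bipartite digraph with sides $A,B$ of size 2 and all four edges from $A$ to $B$. $M'(2m)$: take the undirected tree with bipartition $U\cup W$ in which vertices of $U$ have degree $2m$ and vertices of $W$ have degree $2$; subdivide each edge once; enumerate the neighbourhood of each $u\in U$ by $1,\dots,2m$ so that the two neighbours of each $w\in W$ receive indices of distinct parity; for a subdivision vertex $x$ let $u_x$ be its neighbour in $U$ and $\sigma(x)$ its successor in the cyclic order $1,2,\dots,2m,1$ of $N(u_x)$; for each $w\in W$ let $a_w$ be its neighbour with even index and $b_w$ its neighbour with odd index, and add edges from each of $a_w,\sigma(a_w)$ to each of $b_w,\sigma(b_w)$; finally delete the vertices and edges of the subdivided tree except the subdivision vertices, keeping the added edges. -}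

module Defs where

open import Data.Nat using (ℕ; zero; suc; _≤_; _<_)
open import Data.Nat.DivMod using (_mod_)
open import Data.Fin using (Fin; toℕ; _≟_)
open import Data.Bool using (Bool; true; false; _∧_; _xor_; not; if_then_else_)
open import Data.List using (List; []; _∷_)
open import Data.List.Membership.Propositional using (_∈_; _∉_)
open import Data.Product using (Σ; ∃; _×_; _,_; proj₁)
open import Data.Sum using (_⊎_)
open import Relation.Nullary using (¬_)
open import Relation.Nullary.Decidable using (⌊_⌋)
open import Relation.Binary.PropositionalEquality using (_≡_; _≢_)
open import Relation.Binary.Construct.Closure.ReflexiveTransitive using (Star)
open import Function.Bundles using (_↔_; _⇔_; Inverse; Equivalence)
open import Function.Definitions using (Injective)

record Graph : Set₁ where
  field
    V : Set
    E : V → V → Set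
open Graph public

IsDigraph : Graph → Set
IsDigraph D = V D × (∀ x → ¬ E D x x) × (∀ x y → E D x y → ¬ E D y x)

UAdj : (D : Graph) → V D → V D → Set
UAdj D x y = E D x y ⊎ E D y x

Connected : Graph → Set
Connected D = ∀ x y → Star (UAdj D) x y

Iso : Graph → Graph → Set
Iso G H = Σ (V G ↔ V H) λ f →
  ∀ x y → E G x y ⇔ E H (Inverse.to f x) (Inverse.to f y)

Aut : (X : Set) → (X → X → Set) → Set
Aut X R = Σ (X ↔ X) λ g → ∀ x y → R x y ⇔ R (Inverse.to g x) (Inverse.to g y)

InducedConnected : {X : Set} → (X → X → Set) → {n : ℕ} → (Fin n → X) → Set
InducedConnected R {n} ι = ∀ i j → Star (λ a b → R (ι a) (ι b) ⊎ R (ι b) (ι a)) i j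

-- C-homogeneity of (X , R).  A finite induced sub(di)graph is given by an
-- injective enumeration ι : Fin n → X; an isomorphism between the induced
-- subgraphs on the images of ι₁ and ι₂ is (after reindexing ι₂) the map
-- ι₁ i ↦ ι₂ i, being an isomorphism means R-relations agree.
CHom : (X : Set) → (X → X → Set) → Set
CHom X R = ∀ (n : ℕ) (ι₁ ι₂ : Fin n → X) →
  Injective _≡_ _≡_ ι₁ → Injective _≡_ _≡_ ι₂ →
  InducedConnected R ι₁ →
  (∀ i j → R (ι₁ i) (ι₁ j) ⇔ R (ι₂ i) (ι₂ j)) →
  Σ (Aut X R) λ g → ∀ i → Inverse.to (proj₁ g) (ι₁ i) ≡ ι₂ i

Ray : Graph → Set
Ray D = Σ (ℕ → V D) λ r → Injective _≡_ _≡_ r × (∀ n → UAdj D (r n) (r (suc n)))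

SameComp : (D : Graph) → List (V D) → V D → V D → Set
SameComp D S x y = x ∉ S × y ∉ S ×
  Star (λ a b → UAdj D a b × a ∉ S × b ∉ S) x y

EquivRays : (D : Graph) → Ray D → Ray D → Set
EquivRays D (r , _) (r' , _) = ∀ (S : List (V D)) → ∃ λ n →
  ∀ i j → n ≤ i → n ≤ j → SameComp D S (r i) (r' j)

InfinitelyManyEnds : Graph → Set
InfinitelyManyEnds D = ∀ (k : ℕ) → Σ (Fin k → Ray D) λ f →
  ∀ i j → i ≢ j → ¬ EquivRays D (f i) (f j)

ConnectivityGT1 : Graph → Set
ConnectivityGT1 D =
  (Σ (V D) λ x → Σ (V D) λ y → Σ (V D) λ z → x ≢ y × x ≢ z × y ≢ z) ×
  Connected D ×
  (∀ v x y → x ≢ v → y ≢ v → Star (λ a b → UAdj D a b × a ≢ v × b ≢ v) x y)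

odd : ℕ → Bool
odd zero = false
odd (suc n) = not (odd n)

Dir : (D : Graph) → Bool → V D → V D → Set
Dir D true x y = E D x y
Dir D false x y = E D y x

record AltWalk (D : Graph) : Set where
  field
    len  : ℕ
    pos  : 1 ≤ len
    w    : ℕ → V D
    d    : Bool
    step : ∀ i → i < len → Dir D (d xor odd i) (w i) (w (suc i))

OnWalk : (D : Graph) → AltWalk D → V D → V D → Set
OnWalk D W a b = ∃ λ i → i < len × Tail i ≡ a × Head i ≡ b
  where
  open AltWalk W
  Tail Head : ℕ → V D
  Tail i = if d xor odd i then w i else w (suc i)
  Head i = if d xor odd i then w (suc i) else w i

Reachable : (D : Graph) → V D → V D → V D → V D → Set
Reachable D a b x y = Σ (AltWalk D) λ W → OnWalk D W a b × OnWalk D W x y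

K22 : Graph
K22 = record { V = Bool × Bool ; E = λ p q → proj₁ p ≡ false × proj₁ q ≡ true }

-- Δ_e ≅ K_{2,2} for the edge e = a → b: an injective ψ onto the vertices
-- of Δ_e such that the edges of Δ_e (the edges reachable from e) are
-- exactly the images of the edges of K_{2,2}.
DeltaIsoK22 : (D : Graph) → V D → V D → Set
DeltaIsoK22 D a b = Σ (Bool × Bool → V D) λ ψ → Injective _≡_ _≡_ ψ ×
  (∀ x y → Reachable D a b x y ⇔
     (Σ (Bool × Bool) λ p → Σ (Bool × Bool) λ q →
        x ≡ ψ p × y ≡ ψ q × E K22 p q))

DeltaK22 : Graph → Set
DeltaK22 D = ∀ a b → E D a b → DeltaIsoK22 D a b

-- The digraph M'(2m).
-- The tree T with U of degree 2m and W of degree 2 is the 2m-regular tree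
-- on U with each edge carrying a W-vertex.  A label (i , false) stands for
-- index 2i and (i , true) for 2i+1 (indices 0,…,2m-1, cyclic order
-- 0,1,…,2m-1,0; this is the paper's 1,…,2m with 2m renamed 0).
-- The 2m-regular tree is realised as reduced words: a vertex of U is a
-- reduced list of labels (latest move first); moving from u along label
-- (i , b) arrives at a vertex where the same edge has label (i , not b).

Lab : ℕ → Set
Lab m = Fin m × Bool

isPartner : {m : ℕ} → Lab m → Lab m → Bool
isPartner (i , b) (j , c) = ⌊ i ≟ j ⌋ ∧ (b xor c)

reduced : {m : ℕ} → List (Lab m) → Bool
reduced [] = true
reduced (x ∷ []) = true
reduced (x ∷ y ∷ r) = not (isPartner x y) ∧ reduced (y ∷ r)

move : {m : ℕ} → List (Lab m) → Lab m → List (Lab m)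
move [] l = l ∷ []
move (y ∷ r) l = if isPartner l y then r else l ∷ y ∷ r

sucMod : {m : ℕ} → Fin m → Fin m
sucMod {suc n} i = suc (toℕ i) mod suc n

cyc : {m : ℕ} → Lab m → Lab m
cyc (i , false) = (i , true)
cyc (i , true) = (sucMod i , false)

UVert : ℕ → Set
UVert m = Σ (List (Lab m)) λ w → reduced w ≡ true

-- Subdivision vertices: pairs (u , l), the neighbour of u with index l.
-- For the W-vertex on the tree edge {u , move u (i , false)}:
-- a_w = (u , (i,false)), σ(a_w) = (u , (i,true)),
-- b_w = (v , (i,true)),  σ(b_w) = (v , cyc (i,true)),  v = move u (i,false).
M' : ℕ → Graph
M' m = record
  { V = UVert m × Lab m
  ; E = λ { ((u , _) , l) ((v , _) , k) → Σ (Fin m) λ i →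
          v ≡ move u (i , false) ×
          (l ≡ (i , false) ⊎ l ≡ (i , true)) ×
          (k ≡ (i , true) ⊎ k ≡ cyc (i , true)) }
  }

{-# OPTIONS --safe #-}

-- Every vertex x has a twin τ⁺x with the same out-neighbours and a twin τ⁻x with
-- the same in-neighbours.  Automorphisms commute with τ⁺ and τ⁻, so fixing x they
-- fix its ⟨τ⁺,τ⁻⟩-orbit.  In M'(2m) the orbits are the 2m-cycles σ, and the orbits
-- together with the copies of K₂,₂ joining them form the tree, so the point is that
-- a path leaving an orbit can only return through the K₂,₂ by which it left.
-- Take a shortest path violating this and let b be its last vertex.  C-homogeneity
-- would give an automorphism fixing the rest of the path and moving b to its twin,
-- although it fixes the orbit of the first vertex, which contains b.  The cases in
-- which b and its twin are attached differently to the path lead to shorter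
-- violations or to a directed triangle, and then D has only 12 vertices.  If
-- τ⁺ = τ⁻, then D has at most two ends.  Otherwise a path from τ⁺x to τ⁻x avoiding x
-- has to go around the orbit of x, which is therefore finite.
module Submission where

open import Defs
open import Data.Nat using (ℕ; zero; suc; _≤_; _<_; z≤n; s≤s; _+_; _*_; _∸_; _%_; _/_)
import Data.Nat.DivMod as ℕ
import Data.Nat.Properties as ℕ
open import Data.Nat.Induction using (<-rec)
open import Data.Bool using (Bool; true; false; not; if_then_else_; _xor_)
import Data.Bool.Properties as Bool
open import Data.Empty using (⊥; ⊥-elim)
open import Data.Fin using (Fin; zero; suc)
import Data.Fin as Fin
import Data.Fin.Properties as Fin
open import Data.List using (List; []; _∷_; _++_; _∷ʳ_; length; lookup; deduplicate)
import Data.List.Properties as List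
open import Data.List.Reverse using (Reverse; []; _∶_∶ʳ_; reverseView)
open import Data.List.Membership.Propositional using (_∈_; _∉_; find; lose)
open import Data.List.Membership.Propositional.Properties
  using (∈-lookup; ∈-deduplicate⁺; ∈-deduplicate⁻; ∈-++⁺ˡ; ∈-++⁺ʳ; ∈-++⁻)
import Data.List.Membership.DecPropositional as DecMembership
open import Data.List.Relation.Unary.Any using (here; there; index; any?)
import Data.List.Relation.Unary.Any.Properties as Any
import Data.List.Relation.Unary.All as All
open import Data.List.Relation.Unary.AllPairs using ([]; _∷_)
open import Data.List.Relation.Unary.Unique.Propositional using (Unique)
import Data.List.Relation.Unary.Unique.DecPropositional.Properties as UniqueDec
open import Data.Product using (Σ; ∃; _×_; _,_; proj₁; proj₂)
import Data.Product.Properties as Prod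
open import Data.Sum using (_⊎_; inj₁; inj₂)
open import Axiom.UniquenessOfIdentityProofs using (module Decidable⇒UIP)
open import Function.Bundles using (Inverse; Equivalence; _⇔_; mk⇔; mk↔ₛ′)
open import Function.Definitions using (Injective)
open import Relation.Nullary using (¬_; Dec; yes; no)
open import Relation.Nullary.Decidable using (_⊎-dec_; ¬?; decidable-stable)
open import Relation.Binary.PropositionalEquality
  using (_≡_; _≢_; refl; sym; trans; cong; cong₂; subst; subst₂)
open import Relation.Binary.Construct.Closure.ReflexiveTransitive using (Star; ε; _◅_; _◅◅_)
open import Relation.Binary.Definitions using (DecidableEquality; tri<; tri≈; tri>)

-- C-homogeneity acts on finite connected sets only, and an orbit contains no edge; so an orbit is
-- never prescribed vertex by vertex but is held in place by one of its vertices on the path. The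
-- swapped vertex and its twin must also have the same neighbours in the fixed part: in one
-- direction they always do, and in the other the minimality of the detour shows that neither has
-- any. Hence detours are measured by length, and the remaining cases are split by the directions of
-- the edges along the path. The constant 2m comes from the dihedral action of τ⁺ and τ⁻ on an
-- orbit: m is the order of τ⁻τ⁺ there, the orbit has even size because no power of τ⁻τ⁺ takes x to
-- τ⁺x, and m = 1 would mean τ⁺ = τ⁻.

-- Edges with a chosen direction

flip-Dir : ∀ {D} d {x y} → Dir D d x y → Dir D (not d) y x
flip-Dir true e = e
flip-Dir false e = e

unflip-Dir : ∀ {D} d {x y} → Dir D (not d) x y → Dir D d y x
unflip-Dir true e = e
unflip-Dir false e = e

Dir⇒UAdj : ∀ {D} d {x y} → Dir D d x y → UAdj D x y
Dir⇒UAdj true e = inj₁ e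
Dir⇒UAdj false e = inj₂ e

UAdj⇒Dir : ∀ {D x y} → UAdj D x y → ∃ λ d → Dir D d x y
UAdj⇒Dir (inj₁ e) = true , e
UAdj⇒Dir (inj₂ e) = false , e

UAdj-sym : ∀ {D x y} → UAdj D x y → UAdj D y x
UAdj-sym (inj₁ e) = inj₂ e
UAdj-sym (inj₂ e) = inj₁ e

-- A digraph of in- and out-degree 2 all of whose Δ_e are K₂,₂.  `true` is the
-- outward direction; x and twin d x are the two vertices with the same
-- d-neighbours.
record TwinStructure (D : Graph) : Set where
  field
    nbr : Bool → V D → V D
    nbr-Dir : ∀ d x → Dir D d x (nbr d x)
    twin : Bool → V D → V D
    twin≢ : ∀ d x → twin d x ≢ x
    twin-Dir : ∀ d {x y} → Dir D d x y → Dir D d (twin d x) y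
    only-twin : ∀ d {x x' y} → Dir D d x y → Dir D d x' y → x' ≡ x ⊎ x' ≡ twin d x

-- Twins read off from the copies of K₂,₂

onWalk⇒E : ∀ {D} (W : AltWalk D) {a b} → OnWalk D W a b → E D a b
onWalk⇒E {D} W (i , i<len , tl , hd) = orient (d xor odd i) (step i i<len) tl hd
  where
  open AltWalk W
  orient : ∀ s {x y a b} → Dir D s x y → (if s then x else y) ≡ a → (if s then y else x) ≡ b → E D a b
  orient true e refl refl = e
  orient false e refl refl = e

-- Single vertices are connected induced subdigraphs, and without loops any two of them are
-- isomorphic.
transitive : ∀ {D} → CHom (V D) (E D) → (∀ x → ¬ E D x x) → ∀ x y →
  Σ (Aut (V D) (E D)) λ g → Inverse.to (proj₁ g) x ≡ y
transitive {D} chom loopless x y =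
  let g , fixes = chom 1 (λ _ → x) (λ _ → y) inj inj connected agree in g , fixes zero
  where
  inj : ∀ {z : V D} {i j : Fin 1} → z ≡ z → i ≡ j
  inj {i = zero} {zero} _ = refl
  connected : InducedConnected (E D) {1} (λ _ → x)
  connected zero zero = ε
  agree : ∀ (i j : Fin 1) → E D x x ⇔ E D y y
  agree _ _ = mk⇔ (λ e → ⊥-elim (loopless x e)) (λ e → ⊥-elim (loopless y e))

module FromDelta (D : Graph) (chom : CHom (V D) (E D)) (loopless : ∀ x → ¬ E D x x)
                 (delta : DeltaK22 D) {a b : V D} (a→b : E D a b) where

  three-step : V D → V D → V D → V D → ℕ → V D
  three-step x y z w 0 = x
  three-step x y z w 1 = y
  three-step x y z w 2 = z
  three-step x y z w (suc (suc (suc _))) = w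

  -- The walk y, x, z, w; its edges number 0 and 2 show that the edge between x and y reaches the
  -- edge between z and w.
  zigzag : ∀ d {x y z w} → Dir D (not d) y x → Dir D d x z → Dir D (not d) z w → AltWalk D
  zigzag d {x} {y} {z} {w} e₁ e₂ e₃ = record
    { len = 3 ; pos = s≤s z≤n ; w = three-step y x z w ; d = not d ; step = steps d e₁ e₂ e₃ }
    where
    steps : ∀ d → Dir D (not d) y x → Dir D d x z → Dir D (not d) z w →
      ∀ i → i < 3 → Dir D (not d xor odd i) (three-step y x z w i) (three-step y x z w (suc i))
    steps true e₁ e₂ e₃ 0 _ = e₁
    steps true e₁ e₂ e₃ 1 _ = e₂
    steps true e₁ e₂ e₃ 2 _ = e₃
    steps false e₁ e₂ e₃ 0 _ = e₁
    steps false e₁ e₂ e₃ 1 _ = e₂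
    steps false e₁ e₂ e₃ 2 _ = e₃
    steps _ _ _ _ (suc (suc (suc _))) (s≤s (s≤s (s≤s ())))

  -- The copy of K₂,₂ formed by the d-edges at x, seen from x: `same` is the side of x, whichever
  -- side that is in the orientation of `K22`.
  record Sides (d : Bool) (x : V D) : Set where
    field
      same opposite : Bool → V D
      same-inj : ∀ {c c'} → same c ≡ same c' → c ≡ c'
      joined : ∀ c c' → Dir D d (same c) (opposite c')
      position : ∃ λ c → x ≡ same c
      covers : ∀ {y z} → Dir D d x z → Dir D d y z → ∃ λ c → y ≡ same c
      covers-opposite : ∀ {y z} → Dir D d x z → Dir D d y z → ∃ λ c → z ≡ opposite c

  sides : ∀ d {x y} → Dir D d x y → Sides d x
  sides true {x} {y} e with delta x y e
  ... | ψ , inj , reach = record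
    { same = λ c → ψ (false , c)
    ; opposite = λ c → ψ (true , c)
    ; same-inj = λ eq → cong proj₂ (inj eq)
    ; joined = λ c c' → let W , _ , on = Equivalence.from (reach _ _) (_ , _ , refl , refl , refl , refl) in onWalk⇒E W on
    ; position = tails e e
    ; covers = λ {z} {w} f g → tails f g
    ; covers-opposite = heads
    }
    where
    reached : ∀ {z w} → E D x w → E D z w → Reachable D x y z w
    reached f g = zigzag true e f g , (0 , s≤s z≤n , refl , refl) , (2 , s≤s (s≤s (s≤s z≤n)) , refl , refl)
    tails : ∀ {z w} → E D x w → E D z w → ∃ λ c → z ≡ ψ (false , c)
    tails f g with Equivalence.to (reach _ _) (reached f g)
    ... | (false , c) , q , z≡ , _ , refl , _ = c , z≡
    heads : ∀ {z w} → E D x w → E D z w → ∃ λ c → w ≡ ψ (true , c)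
    heads f g with Equivalence.to (reach _ _) (reached f g)
    ... | p , (true , c) , _ , w≡ , _ , refl = c , w≡
  sides false {x} {y} e with delta y x e
  ... | ψ , inj , reach = record
    { same = λ c → ψ (true , c)
    ; opposite = λ c → ψ (false , c)
    ; same-inj = λ eq → cong proj₂ (inj eq)
    ; joined = λ c c' → let W , _ , on = Equivalence.from (reach _ _) (_ , _ , refl , refl , refl , refl) in onWalk⇒E W on
    ; position = heads e e
    ; covers = λ {z} {w} f g → heads f g
    ; covers-opposite = tails
    }
    where
    reached : ∀ {z w} → E D w x → E D w z → Reachable D y x w z
    reached f g = zigzag false e f g , (0 , s≤s z≤n , refl , refl) , (2 , s≤s (s≤s (s≤s z≤n)) , refl , refl)
    heads : ∀ {z w} → E D w x → E D w z → ∃ λ c → z ≡ ψ (true , c)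
    heads f g with Equivalence.to (reach _ _) (reached f g)
    ... | p , (true , c) , _ , z≡ , _ , refl = c , z≡
    tails : ∀ {z w} → E D w x → E D w z → ∃ λ c → w ≡ ψ (false , c)
    tails f g with Equivalence.to (reach _ _) (reached f g)
    ... | (false , c) , q , w≡ , _ , refl , _ = c , w≡

  neighbour : ∀ d x → ∃ (Dir D d x)
  neighbour true x =
    let (g , pres) , ga≡x = transitive chom loopless a x
    in Inverse.to g b , subst (λ v → E D v (Inverse.to g b)) ga≡x (Equivalence.to (pres a b) a→b)
  neighbour false x =
    let (g , pres) , gb≡x = transitive chom loopless b x
    in Inverse.to g a , subst (E D (Inverse.to g a)) gb≡x (Equivalence.to (pres a b) a→b)

  twinStructure : TwinStructure D
  twinStructure = record
    { nbr = λ d x → proj₁ (neighbour d x)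
    ; nbr-Dir = λ d x → proj₂ (neighbour d x)
    ; twin = tw
    ; twin≢ = λ d x eq → let open Sides (at d x) in
        Bool.not-¬ refl (sym (same-inj (trans eq (proj₂ position))))
    ; twin-Dir = λ d {x} {y} e → let open Sides (at d x); c , y≡ = covers-opposite e e in
        subst (Dir D d (tw d x)) (sym y≡) (joined _ c)
    ; only-twin = only
    }
    where
    at : ∀ d x → Sides d x
    at d x = sides d (proj₂ (neighbour d x))
    tw : Bool → V D → V D
    tw d x = let open Sides (at d x) in same (not (proj₁ position))
    only : ∀ d {x x' y} → Dir D d x y → Dir D d x' y → x' ≡ x ⊎ x' ≡ tw d x
    only d {x} e f with Sides.position (at d x) | Sides.covers (at d x) e f
    ... | c , x≡ | c' , x'≡ with c' Bool.≟ c
    ...   | yes refl = inj₁ (trans x'≡ (sym x≡))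
    ...   | no c'≢c = inj₂ (trans x'≡ (cong (Sides.same (at d x)) (Bool.¬-not c'≢c)))

-- Twins, automorphisms and orbits

lookup-injective : ∀ {A : Set} {xs : List A} → Unique xs → ∀ i j → lookup xs i ≡ lookup xs j → i ≡ j
lookup-injective (_ ∷ _) zero zero _ = refl
lookup-injective (x∉ ∷ _) zero (suc j) eq = ⊥-elim (All.lookup x∉ (∈-lookup j) eq)
lookup-injective (x∉ ∷ _) (suc i) zero eq = ⊥-elim (All.lookup x∉ (∈-lookup i) (sym eq))
lookup-injective (_ ∷ u) (suc i) (suc j) eq = cong suc (lookup-injective u i j eq)

record Setting (D : Graph) : Set where
  field
    loopless : ∀ x → ¬ E D x x
    asymmetric : ∀ x y → E D x y → ¬ E D y x
    connected : Connected D
    homogeneous : CHom (V D) (E D)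
    base : V D
    twins : TwinStructure D
  open TwinStructure twins public

module Twins {D : Graph} (S : Setting D) where
  open Setting S public

  private
    X = V D

  infix 4 _—[_]→_
  _—[_]→_ : X → Bool → X → Set
  x —[ d ]→ y = Dir D d x y

  irreflexive : ∀ d {x} → ¬ x —[ d ]→ x
  irreflexive true = loopless _
  irreflexive false = loopless _

  asym : ∀ d {x y} → x —[ d ]→ y → ¬ y —[ d ]→ x
  asym true = asymmetric _ _
  asym false = asymmetric _ _

  target-twin : ∀ d {x y z} → x —[ d ]→ y → x —[ d ]→ z → z ≡ y ⊎ z ≡ twin (not d) y
  target-twin d e f = only-twin (not d) (flip-Dir d e) (flip-Dir d f)

  to-twin : ∀ d {x y} → x —[ d ]→ y → x —[ d ]→ twin (not d) y
  to-twin d e = unflip-Dir d (twin-Dir (not d) (flip-Dir d e))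

  twin-involutive : ∀ d x → twin d (twin d x) ≡ x
  twin-involutive d x with only-twin d (nbr-Dir d x) (twin-Dir d (twin-Dir d (nbr-Dir d x)))
  ... | inj₁ eq = eq
  ... | inj₂ eq = ⊥-elim (twin≢ d (twin d x) eq)

  untwin-Dir : ∀ d {x y} → twin d x —[ d ]→ y → x —[ d ]→ y
  untwin-Dir d {x} e = subst (λ v → v —[ d ]→ _) (twin-involutive d x) (twin-Dir d e)

  -- A vertex is coded by the turns of the walk from the base vertex that
  -- connectedness provides, which makes equality decidable.
  turn : Bool × Bool → X → X
  turn (d , c) x = if c then nbr d x else twin (not d) (nbr d x)

  follow : X → List (Bool × Bool) → X
  follow x [] = x
  follow x (s ∷ ss) = follow (turn s x) ss

  step-code : ∀ {x y} → UAdj D x y → ∃ λ s → turn s x ≡ y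
  step-code a with UAdj⇒Dir a
  ... | d , e with target-twin d (nbr-Dir d _) e
  ...   | inj₁ eq = (d , true) , sym eq
  ...   | inj₂ eq = (d , false) , sym eq

  walk-code : ∀ {x y} → Star (UAdj D) x y → ∃ λ ss → follow x ss ≡ y
  walk-code ε = [] , refl
  walk-code (a ◅ w) with step-code a | walk-code w
  ... | s , refl | ss , eq = s ∷ ss , eq

  infix 4 _≟_
  _≟_ : DecidableEquality X
  x ≟ y = compare (walk-code (connected base x)) (walk-code (connected base y)) refl refl
    where
    code : X → List (Bool × Bool)
    code z = proj₁ (walk-code (connected base z))
    -- The two equations tie the walks to the function `code`; without them unequal walks would not
    -- separate the vertices.
    compare : (p : ∃ λ ss → follow base ss ≡ x) (q : ∃ λ ss → follow base ss ≡ y) →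
      code x ≡ proj₁ p → code y ≡ proj₁ q → Dec (x ≡ y)
    compare (ss , px) (tt , py) cx cy with List.≡-dec (Prod.≡-dec Bool._≟_ Bool._≟_) ss tt
    ... | yes refl = yes (trans (sym px) py)
    ... | no ss≢tt = no λ { refl → ss≢tt (trans (sym cx) cy) }

  Dir? : ∀ d x y → Dec (x —[ d ]→ y)
  Dir? d x y with y ≟ nbr d x | y ≟ twin (not d) (nbr d x)
  ... | yes refl | _ = yes (nbr-Dir d x)
  ... | no _ | yes refl = yes (to-twin d (nbr-Dir d x))
  ... | no p | no q = no λ e → case-⊎ (target-twin d (nbr-Dir d x) e)
    where
    case-⊎ : y ≡ nbr d x ⊎ y ≡ twin (not d) (nbr d x) → ⊥
    case-⊎ (inj₁ r) = p r
    case-⊎ (inj₂ r) = q r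

  Automorphism : Set
  Automorphism = Aut X (E D)

  ⟦_⟧ : Automorphism → X → X
  ⟦ g ⟧ = Inverse.to (proj₁ g)

  ⟦⟧-Dir : ∀ g d {x y} → x —[ d ]→ y → ⟦ g ⟧ x —[ d ]→ ⟦ g ⟧ y
  ⟦⟧-Dir (g , pres) true = Equivalence.to (pres _ _)
  ⟦⟧-Dir (g , pres) false = Equivalence.to (pres _ _)

  ⟦⟧-injective : ∀ g {x y} → ⟦ g ⟧ x ≡ ⟦ g ⟧ y → x ≡ y
  ⟦⟧-injective (g , _) {x} {y} eq =
    trans (sym (Inverse.strictlyInverseʳ g x)) (trans (cong (Inverse.from g) eq) (Inverse.strictlyInverseʳ g y))

  -- The twin is the only other vertex that shares a d-neighbour with x, a description by edges
  -- alone.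
  ⟦⟧-twin : ∀ g d x → ⟦ g ⟧ (twin d x) ≡ twin d (⟦ g ⟧ x)
  ⟦⟧-twin g d x with only-twin d (⟦⟧-Dir g d (nbr-Dir d x)) (⟦⟧-Dir g d (twin-Dir d (nbr-Dir d x)))
  ... | inj₁ eq = ⊥-elim (twin≢ d x (⟦⟧-injective g eq))
  ... | inj₂ eq = eq

  Linked : List X → Set
  Linked F = ∀ {x y} → x ∈ F → y ∈ F → Star (λ a b → b ∈ F × UAdj D a b) x y

  -- C-homogeneity applied to F ∪ {b} and F ∪ {b'}.
  swap : ∀ (F : List X) → Linked F → ∀ {b b' v} → b ∉ F → b' ∉ F → v ∈ F → UAdj D v b →
    (∀ d {z} → z ∈ F → b —[ d ]→ z ⇔ b' —[ d ]→ z) →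
    Σ Automorphism λ g → (∀ {z} → z ∈ F → ⟦ g ⟧ z ≡ z) × ⟦ g ⟧ b ≡ b'
  swap F linked {b} {b'} {v} b∉F b'∉F v∈F v~b same =
    let g , fixes = homogeneous (suc (length L)) (ι b) (ι b') (ι-inj b∉F) (ι-inj b'∉F) conn agree
    in g , (λ {z} z∈F → let z∈L = ∈-deduplicate⁺ _≟_ z∈F in
              subst (λ u → ⟦ g ⟧ u ≡ u) (sym (Any.lookup-index z∈L)) (fixes (suc (index z∈L)))) , fixes zero
    where
    -- C-homogeneity takes injective enumerations, whereas the vertex list of a path may repeat.
    L = deduplicate _≟_ F
    ι : X → Fin (suc (length L)) → X
    ι c zero = c
    ι c (suc i) = lookup L i
    L⊆F : ∀ i → lookup L i ∈ F
    L⊆F i = ∈-deduplicate⁻ _≟_ F (∈-lookup i)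
    ι-inj : ∀ {c} → c ∉ F → ∀ {i j} → ι c i ≡ ι c j → i ≡ j
    ι-inj c∉F {zero} {zero} _ = refl
    ι-inj c∉F {zero} {suc j} refl = ⊥-elim (c∉F (L⊆F j))
    ι-inj c∉F {suc i} {zero} refl = ⊥-elim (c∉F (L⊆F i))
    ι-inj c∉F {suc i} {suc j} eq = cong suc (lookup-injective (UniqueDec.deduplicate-! _≟_ F) i j eq)
    R : Fin (suc (length L)) → Fin (suc (length L)) → Set
    R i j = UAdj D (ι b i) (ι b j)
    lift : ∀ {x y} → Star (λ a b → b ∈ F × UAdj D a b) x y → ∀ i j → ι b i ≡ x → ι b j ≡ y → Star R i j
    lift ε i j eq₁ eq₂ = subst (Star R i) (ι-inj b∉F (trans eq₁ (sym eq₂))) ε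
    lift ((z∈F , a) ◅ w) i j refl eq =
      let z∈L = ∈-deduplicate⁺ _≟_ z∈F ; k = suc (index z∈L) ; k≡z = sym (Any.lookup-index z∈L)
      in subst (UAdj D (ι b i)) (sym k≡z) a ◅ lift w k j k≡z eq
    lift-F : ∀ i j → Star R (suc i) (suc j)
    lift-F i j = lift (linked (L⊆F i) (L⊆F j)) (suc i) (suc j) refl refl
    v-index = index (∈-deduplicate⁺ _≟_ v∈F)
    v~b' : UAdj D (lookup L v-index) b
    v~b' = subst (λ u → UAdj D u b) (Any.lookup-index (∈-deduplicate⁺ _≟_ v∈F)) v~b
    conn : InducedConnected (E D) (ι b)
    conn zero zero = ε
    conn zero (suc j) = UAdj-sym {D} v~b' ◅ lift-F v-index j
    conn (suc i) zero = lift-F i v-index ◅◅ (v~b' ◅ ε)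
    conn (suc i) (suc j) = lift-F i j
    agree : ∀ i j → E D (ι b i) (ι b j) ⇔ E D (ι b' i) (ι b' j)
    agree zero zero = mk⇔ (λ e → ⊥-elim (loopless _ e)) (λ e → ⊥-elim (loopless _ e))
    agree zero (suc j) = same true (L⊆F j)
    agree (suc i) zero = same false (L⊆F i)
    agree (suc i) (suc j) = mk⇔ (λ e → e) (λ e → e)

  data Orb (x : X) : X → Set where
    here : Orb x x
    _∷twin_ : ∀ {y} → Orb x y → ∀ d → Orb x (twin d y)

  Orb-trans : ∀ {x y z} → Orb x y → Orb y z → Orb x z
  Orb-trans p here = p
  Orb-trans p (q ∷twin d) = Orb-trans p q ∷twin d

  Orb-twin : ∀ d x → Orb (twin d x) x
  Orb-twin d x = subst (Orb (twin d x)) (twin-involutive d x) (here ∷twin d)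

  Orb-sym : ∀ {x y} → Orb x y → Orb y x
  Orb-sym here = here
  Orb-sym (p ∷twin d) = Orb-trans (Orb-twin d _) (Orb-sym p)

  rigid : ∀ g {x y} → Orb x y → ⟦ g ⟧ x ≡ x → ⟦ g ⟧ y ≡ y
  rigid g here fix = fix
  rigid g (p ∷twin d) fix = trans (⟦⟧-twin g d _) (cong (twin d) (rigid g p fix))

  -- Two d-neighbours of c always agree in the direction `not d`; in direction d they agree here
  -- because neither has an edge into F.
  agree-on : ∀ d {c b} → c —[ d ]→ b → ∀ {F : List X} →
    (∀ {β z} → c —[ d ]→ β → z ∈ F → ¬ β —[ d ]→ z) →
    ∀ d' {z} → z ∈ F → b —[ d' ]→ z ⇔ twin (not d) b —[ d' ]→ z
  agree-on d e none d' z∈F with d' Bool.≟ d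
  ... | yes refl = mk⇔ (λ f → ⊥-elim (none e z∈F f)) (λ f → ⊥-elim (none (to-twin d e) z∈F f))
  ... | no d'≢d rewrite Bool.¬-not d'≢d = mk⇔ (twin-Dir (not d)) (untwin-Dir (not d))

  swap-target : ∀ d {x y} → x —[ d ]→ y →
    Σ Automorphism λ g → ⟦ g ⟧ x ≡ x × ⟦ g ⟧ y ≡ twin (not d) y
  swap-target d {x} {y} e =
    let g , fixes , moved = swap (x ∷ []) (λ { (here refl) (here refl) → ε })
          (λ { (here refl) → irreflexive d e }) (λ { (here refl) → irreflexive d (to-twin d e) })
          (here refl) (Dir⇒UAdj d e) (agree-on d e (λ { x→β (here refl) → asym d x→β }))
    in g , fixes (here refl) , moved

  -- The automorphism that fixes x and exchanges y for its twin would have to fix y, if y were in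
  -- the orbit of x.
  not-adjacent : ∀ d {x y} → x —[ d ]→ y → ¬ Orb x y
  not-adjacent d {x} {y} e p =
    let g , fixed , moved = swap-target d e
    in twin≢ (not d) y (trans (sym moved) (rigid g p fixed))

-- Directed triangles force finiteness

-- If `suc (length L)` consecutive terms all lay in L, two of them would occupy the same position of
-- L.
leaves-list : ∀ {A : Set} (_≟_ : DecidableEquality A) {r : ℕ → A} → Injective _≡_ _≡_ r →
  (L : List A) → ∀ i → ∃ λ j → i ≤ j × r j ∉ L
leaves-list {A} _≟_ {r} r-inj L i with Fin.any? {suc (length L)} (λ k → ¬? (r (i + Fin.toℕ k) ∈? L))
  where open DecMembership _≟_ using (_∈?_)
... | yes (k , out) = i + Fin.toℕ k , ℕ.m≤m+n i _ , out
... | no none = ⊥-elim (ℕ.<⇒≢ k<l (ℕ.+-cancelˡ-≡ i _ _ (r-inj same)))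
  where
  open DecMembership _≟_ using (_∈?_)
  within : ∀ k → r (i + Fin.toℕ k) ∈ L
  within k = decidable-stable (_ ∈? L) (λ out → none (k , out))
  collision = Fin.pigeonhole ℕ.≤-refl (λ k → index (within k))
  k<l = proj₁ (proj₂ (proj₂ collision))
  same : r (i + Fin.toℕ (proj₁ collision)) ≡ r (i + Fin.toℕ (proj₁ (proj₂ collision)))
  same = trans (Any.lookup-index (within _))
           (trans (cong (lookup L) (proj₂ (proj₂ (proj₂ collision)))) (sym (Any.lookup-index (within _))))

module NoTriangles {D : Graph} (S : Setting D) {r : ℕ → V D} (r-inj : Injective _≡_ _≡_ r)
    (twins-differ : ∀ x → Setting.twin S true x ≢ Setting.twin S false x) where
  open Twins S

  private
    X = V D
    infix 4 _→→_
    _→→_ : X → X → Set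
    x →→ y = x —[ true ]→ y

    Triangle : X → X → X → Set
    Triangle x y z = x →→ y × y →→ z × z →→ x

  module _ {x₀ y₀ z₀ : X} (tri₀ : Triangle x₀ y₀ z₀) where

    triangle-at : ∀ x → ∃ λ y → ∃ λ z → Triangle x y z
    triangle-at x with transitive homogeneous loopless x₀ x
    ... | g , refl = let e , f , h = tri₀ in
      _ , _ , ⟦⟧-Dir g true e , ⟦⟧-Dir g true f , ⟦⟧-Dir g true h

    -- One of the two out-edges at x lies on a triangle, and an automorphism fixing x carries it to
    -- the other.
    triangle-on : ∀ {x y} → x →→ y → ∃ λ z → y →→ z × z →→ x
    triangle-on {x} {y} e with triangle-at x
    ... | y' , z , e' , f , h with target-twin true e' e
    ...   | inj₁ refl = z , f , h
    ...   | inj₂ refl with swap-target true e'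
    ...     | g , gx≡x , gy'≡y = ⟦ g ⟧ z , subst (_→→ ⟦ g ⟧ z) gy'≡y (⟦⟧-Dir g true f) ,
                                 subst (⟦ g ⟧ z →→_) gx≡x (⟦⟧-Dir g true h)

    -- The four edges from a and `twin true a` to b and `twin false b` each lie on a triangle, with
    -- third vertices v, c₂, c₃, c₄. Triangles on two edges with a common end have third vertices
    -- that are twins, and distinct ones since τ⁺ and τ⁻ differ. Going from v to c₄ by way of c₂ or
    -- of c₃ gives the two composites.
    twins-commute : ∀ v → twin false (twin true v) ≡ twin true (twin false v)
    twins-commute v with triangle-at v
    ... | a , b , va , ab , bv
      with triangle-on (to-twin true ab) | triangle-on (twin-Dir true ab) | triangle-on (to-twin true (twin-Dir true ab))
    ... | c₂ , b'c₂ , c₂a | c₃ , bc₃ , c₃a' | c₄ , b'c₄ , c₄a' = trans (sym c₄≡FT) c₄≡TF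
      where
      heads : ∀ {c} → b →→ c → twin false b →→ c → ⊥
      heads p q with only-twin true p q
      ... | inj₁ eq = twin≢ false b eq
      ... | inj₂ eq = twins-differ b (sym eq)
      tails : ∀ {c} → c →→ a → c →→ twin true a → ⊥
      tails p q with target-twin true p q
      ... | inj₁ eq = twin≢ true a eq
      ... | inj₂ eq = twins-differ a eq
      c₂≡T : c₂ ≡ twin true v
      c₂≡T with only-twin true va c₂a
      ... | inj₁ refl = ⊥-elim (heads bv b'c₂)
      ... | inj₂ eq = eq
      c₃≡F : c₃ ≡ twin false v
      c₃≡F with target-twin true bv bc₃
      ... | inj₁ refl = ⊥-elim (tails va c₃a')
      ... | inj₂ eq = eq
      c₄≡FT : c₄ ≡ twin false (twin true v)
      c₄≡FT with target-twin true b'c₂ b'c₄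
      ... | inj₁ refl = ⊥-elim (tails c₂a c₄a')
      ... | inj₂ eq = trans eq (cong (twin false) c₂≡T)
      c₄≡TF : c₄ ≡ twin true (twin false v)
      c₄≡TF with only-twin true c₃a' c₄a'
      ... | inj₁ refl = ⊥-elim (heads bc₃ b'c₄)
      ... | inj₂ eq = trans eq (cong (twin true) c₃≡F)

    four : X → List X
    four v = v ∷ twin true v ∷ twin false v ∷ twin true (twin false v) ∷ []

    Orb⊆four : ∀ {v w} → Orb v w → w ∈ four v
    Orb⊆four here = here refl
    Orb⊆four (p ∷twin d) = closed d (Orb⊆four p)
      where
      closed : ∀ d {v w} → w ∈ four v → twin d w ∈ four v
      closed true (here refl) = there (here refl)
      closed false (here refl) = there (there (here refl))
      closed true (there (here refl)) = here (twin-involutive true _)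
      closed false (there (here refl)) = there (there (there (here (twins-commute _))))
      closed true (there (there (here refl))) = there (there (there (here refl)))
      closed false (there (there (here refl))) = here (twin-involutive false _)
      closed true (there (there (there (here refl)))) = there (there (here (twin-involutive true _)))
      closed false (there (there (there (here refl)))) =
        there (here (trans (twins-commute _) (cong (twin true) (twin-involutive false _))))

    -- For an in-twin w of u, take a common in-neighbour c: the triangles on c → u and c → w have
    -- third vertices with the common out-neighbour c, which are therefore equal or out-twins.
    out-Orb : ∀ {x y w z} → x →→ y → Orb x w → w →→ z → Orb y z
    out-Orb e here f with target-twin true e f
    ... | inj₁ refl = here
    ... | inj₂ refl = here ∷twin false
    out-Orb e (p ∷twin true) f = out-Orb e p (untwin-Dir true f)
    out-Orb {y = y} e (_∷twin_ {u} p false) f with nbr-Dir false u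
    ... | c→u with triangle-on c→u | triangle-on (to-twin true c→u)
    ...   | q , u→q , q→c | s , w→s , s→c = spread (target-twin true w→s f) (shift (only-twin true q→c s→c))
      where
      shift : s ≡ q ⊎ s ≡ twin true q → Orb y s
      shift (inj₁ refl) = out-Orb e p u→q
      shift (inj₂ refl) = out-Orb e p u→q ∷twin true
      spread : ∀ {z} → z ≡ s ⊎ z ≡ twin false s → Orb y s → Orb y z
      spread (inj₁ refl) o = o
      spread (inj₂ refl) o = o ∷twin false

    everything : List X
    everything = four x₀ ++ (four y₀ ++ four z₀)

    data Covered (w : X) : Set where
      in-x : Orb x₀ w → Covered w
      in-y : Orb y₀ w → Covered w
      in-z : Orb z₀ w → Covered w

    covered⇒∈ : ∀ {w} → Covered w → w ∈ everything
    covered⇒∈ (in-x p) = ∈-++⁺ˡ (Orb⊆four p)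
    covered⇒∈ (in-y p) = ∈-++⁺ʳ (four x₀) (∈-++⁺ˡ (Orb⊆four p))
    covered⇒∈ (in-z p) = ∈-++⁺ʳ (four x₀) (∈-++⁺ʳ (four y₀) (Orb⊆four p))

    covered-out : ∀ {v w} → Covered v → v →→ w → Covered w
    covered-out (in-x p) e = in-y (out-Orb (proj₁ tri₀) p e)
    covered-out (in-y p) e = in-z (out-Orb (proj₁ (proj₂ tri₀)) p e)
    covered-out (in-z p) e = in-x (out-Orb (proj₂ (proj₂ tri₀)) p e)

    covered : ∀ {v w} → Star (UAdj D) v w → Covered v → Covered w
    covered ε c = c
    covered (inj₁ e ◅ p) c = covered p (covered-out c e)
    -- A step against an edge is replaced by the other two edges of a triangle on it.
    covered (inj₂ e ◅ p) c =
      let _ , f , h = triangle-on e in covered p (covered-out (covered-out c f) h)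

    finite : ⊥
    finite = let j , _ , out = leaves-list _≟_ r-inj everything 0 in
      out (covered⇒∈ (covered (connected x₀ (r j)) (in-x here)))

  no-triangle : ∀ d {x y z} → x —[ d ]→ y → y —[ d ]→ z → ¬ z —[ d ]→ x
  no-triangle true e f h = finite (e , f , h)
  no-triangle false e f h = finite (h , f , e)

-- Coinciding twins leave at most two ends

-- If τ⁺ = τ⁻ then D is a directed cycle or a directed double ray with each vertex
-- doubled, so it has at most two ends.
module Parallel {D : Graph} (S : Setting D) (ends : InfinitelyManyEnds D)
    (parallel : ∀ x → Setting.twin S true x ≡ Setting.twin S false x) where
  open Twins S renaming (base to o)

  private
    X = V D

  twin≡ : ∀ d d' x → twin d x ≡ twin d' x
  twin≡ true true x = refl
  twin≡ true false x = parallel x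
  twin≡ false true x = sym (parallel x)
  twin≡ false false x = refl

  InPair : X → X → Set
  InPair x y = y ≡ x ⊎ y ≡ twin true x

  pair-target : ∀ d {x y z} → x —[ d ]→ y → x —[ d ]→ z → InPair y z
  pair-target d e f with target-twin d e f
  ... | inj₁ eq = inj₁ eq
  ... | inj₂ eq = inj₂ (trans eq (twin≡ (not d) true _))

  pair-source : ∀ d {x y z} → InPair x y → x —[ d ]→ z → y —[ d ]→ z
  pair-source d (inj₁ refl) e = e
  pair-source d {x} {z = z} (inj₂ refl) e = subst (_—[ d ]→ z) (twin≡ d true x) (twin-Dir d e)

  pair-sym : ∀ {x y} → InPair x y → InPair y x
  pair-sym (inj₁ refl) = inj₁ refl
  pair-sym (inj₂ refl) = inj₂ (sym (twin-involutive true _))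

  pair-trans : ∀ {x y z} → InPair x y → InPair y z → InPair x z
  pair-trans (inj₁ refl) q = q
  pair-trans (inj₂ refl) (inj₁ refl) = inj₂ refl
  pair-trans (inj₂ refl) (inj₂ refl) = inj₁ (twin-involutive true _)

  three-in-pair : ∀ {x a b c} → InPair x a → InPair x b → InPair x c → a ≡ b ⊎ a ≡ c ⊎ b ≡ c
  three-in-pair (inj₁ p) (inj₁ q) _ = inj₁ (trans p (sym q))
  three-in-pair (inj₂ p) (inj₂ q) _ = inj₁ (trans p (sym q))
  three-in-pair (inj₁ p) (inj₂ _) (inj₁ q) = inj₂ (inj₁ (trans p (sym q)))
  three-in-pair (inj₂ p) (inj₁ _) (inj₂ q) = inj₂ (inj₁ (trans p (sym q)))
  three-in-pair (inj₁ _) (inj₂ p) (inj₂ q) = inj₂ (inj₂ (trans p (sym q)))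
  three-in-pair (inj₂ _) (inj₁ p) (inj₁ q) = inj₂ (inj₂ (trans p (sym q)))

  up : Bool → ℕ → X
  up d zero = o
  up d (suc h) = nbr d (up d h)

  -- A record, since `up` reduces and d and h could not be inferred from the bare `InPair`.
  record Level (d : Bool) (h : ℕ) (x : X) : Set where
    constructor in-level
    field
      pair : InPair (up d h) x

  level-up : ∀ d {h x y} → Level d h x → x —[ d ]→ y → Level d (suc h) y
  level-up d (in-level p) e = in-level (pair-target d (nbr-Dir d _) (pair-source d (pair-sym p) e))

  level-down : ∀ d {h x y} → Level d (suc h) x → x —[ not d ]→ y → Level d h y
  level-down d (in-level p) e =
    in-level (pair-target (not d) (pair-source (not d) p (flip-Dir d (nbr-Dir d _))) e)

  level-cancel : ∀ d h {k x} → Level d h x → Level d (h + k) x → Level d k o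
  level-cancel d zero (in-level p) (in-level q) = in-level (pair-trans q (pair-sym p))
  level-cancel d (suc h) p q = level-cancel d h (level-down d p (nbr-Dir (not d) _)) (level-down d q (nbr-Dir (not d) _))

  -- Going down in direction d is going up in the opposite one, so the h steps back to level 0 add
  -- to k.
  level-opposite : ∀ d h {k x} → Level d h x → Level (not d) k x → Level (not d) (h + k) o
  level-opposite d zero (in-level p) (in-level q) = in-level (pair-trans q (pair-sym p))
  level-opposite d (suc h) {k} p q = subst (λ n → Level (not d) n o) (ℕ.+-suc h k)
    (level-opposite d h (level-down d p (nbr-Dir (not d) _)) (level-up (not d) q (nbr-Dir (not d) _)))

  tower : Bool → ℕ → List X
  tower d zero = o ∷ twin true o ∷ []
  tower d (suc h) = up d (suc h) ∷ twin true (up d (suc h)) ∷ tower d h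

  level⇒∈tower : ∀ {d h H x} → h ≤ H → Level d h x → x ∈ tower d H
  level⇒∈tower {H = zero} z≤n (in-level (inj₁ eq)) = here eq
  level⇒∈tower {H = zero} z≤n (in-level (inj₂ eq)) = there (here eq)
  level⇒∈tower {H = suc H} h≤ p with ℕ.m≤n⇒m<n∨m≡n h≤
  ... | inj₁ (s≤s h≤H) = there (there (level⇒∈tower h≤H p))
  level⇒∈tower {H = suc H} h≤ (in-level (inj₁ eq)) | inj₂ refl = here eq
  level⇒∈tower {H = suc H} h≤ (in-level (inj₂ eq)) | inj₂ refl = there (here eq)

  ray₀ : Ray D
  ray₀ = proj₁ (ends 1) zero

  -- Otherwise the levels 0 to h would be closed under adjacency, and D would be finite and contain
  -- no ray.
  not-cyclic : ∀ d h → ¬ Level d (suc h) o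
  not-cyclic d h (in-level cycle) =
    let j , _ , out = leaves-list _≟_ (proj₁ (proj₂ ray₀)) (tower d h) 0
        k , k≤h , p = low (connected o (proj₁ ray₀ j)) (0 , z≤n , in-level (inj₁ refl))
    in out (level⇒∈tower k≤h p)
    where
    Low : X → Set
    Low x = ∃ λ k → k ≤ h × Level d k x
    above : ∀ {x y} → Low x → x —[ d ]→ y → Low y
    above (k , k≤h , p) e with ℕ.m≤n⇒m<n∨m≡n k≤h
    ... | inj₁ k<h = suc k , k<h , level-up d p e
    ... | inj₂ refl = 0 , z≤n , in-level (pair-trans (pair-sym cycle) (Level.pair (level-up d p e)))
    below : ∀ {x y} → Low x → x —[ not d ]→ y → Low y
    below (suc k , k<h , p) e = k , ℕ.<⇒≤ k<h , level-down d p e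
    -- Because of the cycle, level 0 is also level `suc h`.
    below (zero , _ , in-level p) e = h , ℕ.≤-refl , level-down d (in-level (pair-trans cycle p)) e
    low : ∀ {x y} → Star (UAdj D) x y → Low x → Low y
    low ε l = l
    low (a ◅ w) l with UAdj⇒Dir {D} a
    ... | s , e with s Bool.≟ d
    ...   | yes refl = low w (above l e)
    ...   | no s≢d rewrite Bool.¬-not s≢d = low w (below l e)

  not-cyclic′ : ∀ d h → Level d h o → h ≡ 0
  not-cyclic′ d zero _ = refl
  not-cyclic′ d (suc h) p = ⊥-elim (not-cyclic d h p)

  level-unique : ∀ d {h k x} → Level d h x → Level d k x → h ≡ k
  level-unique d {h} {k} p q with ℕ.≤-total h k
  ... | inj₁ h≤k with ℕ.m≤n⇒∃[o]m+o≡n h≤k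
  ...   | l , refl = sym (trans (cong (h +_) (not-cyclic′ d l (level-cancel d h p q))) (ℕ.+-identityʳ h))
  level-unique d {h} {k} p q | inj₂ k≤h with ℕ.m≤n⇒∃[o]m+o≡n k≤h
  ...   | l , refl = trans (cong (k +_) (not-cyclic′ d l (level-cancel d k q p))) (ℕ.+-identityʳ k)

  level-total : ∀ x → ∃ λ d → ∃ λ h → Level d h x
  level-total x = go (connected o x) (true , 0 , in-level (inj₁ refl))
    where
    go : ∀ {x y} → Star (UAdj D) x y → (∃ λ d → ∃ λ h → Level d h x) → ∃ λ d → ∃ λ h → Level d h y
    go ε l = l
    go (a ◅ w) (d , h , p) with UAdj⇒Dir {D} a
    ... | s , e with s Bool.≟ d
    ...   | yes refl = go w (d , suc h , level-up d p e)
    ...   | no s≢d rewrite Bool.¬-not s≢d with h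
    ...     | zero = go w (not d , 1 , level-up (not d) (in-level (Level.pair p)) e)
    ...     | suc h' = go w (d , h' , level-down d p e)

  -- The ray need not rise monotonically; it only stays on the d-side of `o`.
  record Climbing (d : Bool) (r : ℕ → X) : Set where
    field
      injective : Injective _≡_ _≡_ r
      adjacent : ∀ n → UAdj D (r n) (r (suc n))
      height : ℕ → ℕ
      level : ∀ n → Level d (height n) (r n)

    height-step : ∀ n → height (suc n) ≡ suc (height n) ⊎ height n ≡ suc (height (suc n))
    height-step n with UAdj⇒Dir {D} (adjacent n)
    ... | s , e with s Bool.≟ d
    ...   | yes refl = inj₁ (level-unique d (level (suc n)) (level-up d (level n) e))
    ...   | no s≢d rewrite Bool.¬-not s≢d with height n | level n
    ...     | suc h | p = inj₂ (cong suc (level-unique d (level-down d p e) (level (suc n))))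
    ...     | zero | p = ⊥-elim (not-cyclic (not d) (height (suc n))
              (subst (λ k → Level (not d) k o) (ℕ.+-comm (height (suc n)) 1)
                (level-opposite d (height (suc n)) (level (suc n)) (level-up (not d) (in-level (Level.pair p)) e))))

    three-at : ∀ {H a b c} → height a ≡ H → height b ≡ H → height c ≡ H → a < b → a < c → b ≡ c
    three-at {H} {a} {b} {c} p q s a<b a<c with three-in-pair (Level.pair (on a p)) (Level.pair (on b q)) (Level.pair (on c s))
      where
      on : ∀ n → height n ≡ H → Level d H (r n)
      on n eq = subst (λ h → Level d h (r n)) eq (level n)
    ... | inj₁ eq = ⊥-elim (ℕ.<⇒≢ a<b (injective eq))
    ... | inj₂ (inj₁ eq) = ⊥-elim (ℕ.<⇒≢ a<c (injective eq))
    ... | inj₂ (inj₂ eq) = injective eq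

    unbounded : ∀ H i → ∃ λ j → i ≤ j × H < height j
    unbounded H i = let j , i≤j , out = leaves-list _≟_ injective (tower d H) i in
      j , i≤j , ℕ.≰⇒> λ h≤H → out (level⇒∈tower h≤H (level j))

    crosses-up : ∀ H a k → height a ≤ H → H < height (a + k) →
      ∃ λ c → a ≤ c × c < a + k × height c ≡ H × height (suc c) ≡ suc H
    crosses-up H a zero low high = ⊥-elim (ℕ.<⇒≱ high (subst (λ n → height n ≤ H) (sym (ℕ.+-identityʳ a)) low))
    crosses-up H a (suc k) low high rewrite ℕ.+-suc a k with ℕ.<-≤-connex H (height (a + k))
    ... | inj₁ high' = let c , a≤c , c< , p , q = crosses-up H a k low high' in c , a≤c , ℕ.m<n⇒m<1+n c< , p , q
    ... | inj₂ low' with height-step (a + k)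
    ...   | inj₁ eq = let h≡H = ℕ.≤-antisym low' (ℕ.≤-pred (subst (H <_) eq high)) in
              a + k , ℕ.m≤m+n a k , ℕ.≤-refl , h≡H , trans eq (cong suc h≡H)
    ...   | inj₂ eq = ⊥-elim (ℕ.<⇒≱ high (ℕ.≤-trans (ℕ.n≤1+n _) (subst (_≤ H) eq low')))

    crosses-down : ∀ H a k → H < height a → height (a + k) ≤ H →
      ∃ λ c → a ≤ c × c < a + k × height c ≡ suc H × height (suc c) ≡ H
    crosses-down H a zero high low = ⊥-elim (ℕ.<⇒≱ high (subst (λ n → height n ≤ H) (ℕ.+-identityʳ a) low))
    crosses-down H a (suc k) high low rewrite ℕ.+-suc a k with ℕ.<-≤-connex H (height (a + k))
    ... | inj₂ low' = let c , a≤c , c< , p , q = crosses-down H a k high low' in c , a≤c , ℕ.m<n⇒m<1+n c< , p , q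
    ... | inj₁ high' with height-step (a + k)
    ...   | inj₂ eq = let h≡H = ℕ.≤-antisym low (ℕ.≤-pred (subst (H <_) eq high')) in
              a + k , ℕ.m≤m+n a k , ℕ.≤-refl , trans eq (cong suc h≡H) , h≡H
    ...   | inj₁ eq = ⊥-elim (ℕ.<⇒≱ high' (ℕ.≤-trans (ℕ.n≤1+n _) (subst (_≤ H) eq low)))

    -- After the ray crosses from level H to level H + 1 it can only return
    -- within two steps, since it must cross twice more and each level has only two
    -- vertices.
    tends : ∀ M → ∃ λ n → ∀ i → n ≤ i → M < height i
    tends M =
      -- This H is at least the initial height, so that some crossing upwards from H exists, and at
      -- least M.
      let H = height 0 + M
          j , _ , high = unbounded H 0
          c₀ , _ , _ , p₀ , q₀ = crosses-up H 0 j (ℕ.m≤m+n (height 0) M) high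
      in 3 + c₀ , λ i n≤i → ℕ.≤-<-trans (ℕ.m≤n+m M (height 0)) (ℕ.≰⇒> (no-return H c₀ p₀ q₀ i n≤i))
      where
      no-return : ∀ H c₀ → height c₀ ≡ H → height (suc c₀) ≡ suc H → ∀ i → 3 + c₀ ≤ i → ¬ height i ≤ H
      no-return H c₀ p₀ q₀ i n≤i low
        with ℕ.m≤n⇒∃[o]m+o≡n (ℕ.≤-trans (ℕ.m≤n+m (suc c₀) 2) n≤i) | unbounded H i
      ... | k , refl | j , i≤j , high with ℕ.m≤n⇒∃[o]m+o≡n i≤j
      ...   | l , refl with crosses-down H (suc c₀) k (ℕ.≤-reflexive (sym q₀)) low | crosses-up H (suc c₀ + k) l low high
      ...     | c₁ , c₀<c₁ , c₁<i , p₁ , q₁ | c₂ , i≤c₂ , _ , p₂ , q₂ = ℕ.<⇒≱ n≤i (ℕ.≤-trans i≤c₂ (ℕ.≤-reflexive c₂≡))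
        where
        c₁<c₂ : c₁ < c₂
        c₁<c₂ = ℕ.<-≤-trans c₁<i i≤c₂
        -- Here c₁ is a crossing down and c₂ a later crossing up. If c₁ came after `suc c₀`, level
        -- `suc H` would be met at `suc c₀`, c₁ and `suc c₂`. Otherwise level H is met at c₀,
        -- `2 + c₀` and c₂, so the last two coincide, too early for i.
        c₂≡ : c₂ ≡ 2 + c₀
        c₂≡ with ℕ.m≤n⇒m<n∨m≡n c₀<c₁
        ... | inj₁ lt = ⊥-elim (ℕ.<⇒≢ (ℕ.m<n⇒m<1+n c₁<c₂) (three-at q₀ p₁ q₂ lt (ℕ.<-trans lt (ℕ.m<n⇒m<1+n c₁<c₂))))
        ... | inj₂ refl = sym (three-at p₀ q₁ p₂ (ℕ.m<n⇒m<1+n c₀<c₁) (ℕ.<-trans c₀<c₁ c₁<c₂))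

  Climbs : Bool → Ray D → Set
  Climbs d (r , _) = ∃ λ N → ∀ i → N ≤ i → ∃ λ h → Level d h (r i)

  climbs-tends : ∀ d (ray : Ray D) → Climbs d ray →
    ∀ M → ∃ λ n → ∀ i → n ≤ i → ∃ λ h → M < h × Level d h (proj₁ ray i)
  climbs-tends d (r , r-inj , r-adj) (N , climbs) M =
    let n , big = tends M in N + n , λ i N+n≤i →
      let N≤i = ℕ.≤-trans (ℕ.m≤m+n N n) N+n≤i
          k = i ∸ N
          N+k≡i = ℕ.m+[n∸m]≡n N≤i
      in height k , big k (ℕ.+-cancelˡ-≤ N n k (subst (N + n ≤_) (sym N+k≡i) N+n≤i))
         , subst (λ j → Level d (height k) (r j)) N+k≡i (level k)
    where
    shifted : Climbing d (λ k → r (N + k))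
    shifted = record
      { injective = λ eq → ℕ.+-cancelˡ-≡ N _ _ (r-inj eq)
      ; adjacent = λ k → subst (λ j → UAdj D (r (N + k)) (r j)) (sym (ℕ.+-suc N k)) (r-adj (N + k))
      ; height = λ k → proj₁ (climbs (N + k) (ℕ.m≤m+n N k))
      ; level = λ k → proj₂ (climbs (N + k) (ℕ.m≤m+n N k)) }
    open Climbing shifted

  Avoiding : List X → X → X → Set
  Avoiding S a b = UAdj D a b × a ∉ S × b ∉ S

  level-bound : ∀ d (S : List X) → ∃ λ M → ∀ {h x} → x ∈ S → Level d h x → h ≤ M
  level-bound d [] = 0 , λ ()
  level-bound d (y ∷ S) with level-bound d S | level-total y
  ... | M , bound | d' , k , q = k + M , λ
    { (here refl) p → ℕ.≤-trans (own p) (ℕ.m≤m+n k M)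
    ; (there x∈S) p → ℕ.≤-trans (bound x∈S p) (ℕ.m≤n+m M k) }
    where
    -- A vertex at a level of the opposite side can only have level 0 in direction d.
    own : ∀ {h} → Level d h y → h ≤ k
    own {h} p with d' Bool.≟ d
    ... | yes refl = ℕ.≤-reflexive (level-unique d p q)
    ... | no d'≢d rewrite Bool.¬-not d'≢d =
      ℕ.≤-trans (ℕ.≤-reflexive (ℕ.m+n≡0⇒m≡0 h (not-cyclic′ (not d) (h + k) (level-opposite d h p q)))) z≤n

  equivalent : ∀ d (ray ray' : Ray D) → Climbs d ray → Climbs d ray' → EquivRays D ray ray'
  equivalent d ray ray' climbs climbs' S =
    let M , bound = level-bound d S
        n , high = climbs-tends d ray climbs M
        n' , high' = climbs-tends d ray' climbs' M
    in n + n' , λ i j i≥ j≥ →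
      let a , M<a , p = high i (ℕ.≤-trans (ℕ.m≤m+n n n') i≥)
          b , M<b , q = high' j (ℕ.≤-trans (ℕ.m≤n+m n' n) j≥)
      in joined M bound M<a p M<b q
    where
    joined : ∀ M → (∀ {h x} → x ∈ S → Level d h x → h ≤ M) →
      ∀ {a b x y} → M < a → Level d a x → M < b → Level d b y → SameComp D S x y
    joined M bound {a} {b} {x} {y} M<a p M<b q =
      clear M<a p , clear M<b q ,
      -- Both vertices are led up to the common height `suc (a + b)`.
      (climb M<a p b ◅◅ subst (λ n → Star (Avoiding S) (up d n) y) (cong suc (ℕ.+-comm b a)) (back (climb M<b q a)))
      where
      clear : ∀ {h z} → M < h → Level d h z → z ∉ S
      clear M<h p z∈S = ℕ.<⇒≱ M<h (bound z∈S p)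
      climb : ∀ {h z} → M < h → Level d h z → ∀ k → Star (Avoiding S) z (up d (suc h + k))
      climb {h} {z} M<h p@(in-level p') zero rewrite ℕ.+-identityʳ h =
        (Dir⇒UAdj d (pair-source d p' (nbr-Dir d _)) , clear M<h p , clear (ℕ.m<n⇒m<1+n M<h) (in-level (inj₁ refl))) ◅ ε
      climb {h} {z} M<h p (suc k) rewrite ℕ.+-suc h k = climb M<h p k ◅◅
        ((Dir⇒UAdj d (nbr-Dir d _) , clear (beyond h k M<h) (in-level (inj₁ refl))
          , clear (ℕ.m<n⇒m<1+n (beyond h k M<h)) (in-level (inj₁ refl))) ◅ ε)
        where
        beyond : ∀ h k → M < h → M < suc h + k
        beyond h k M<h = ℕ.m<n⇒m<1+n (ℕ.<-≤-trans M<h (ℕ.m≤m+n h k))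
      back : ∀ {z w} → Star (Avoiding S) z w → Star (Avoiding S) w z
      back ε = ε
      back ((e , u , v) ◅ w) = back w ◅◅ ((UAdj-sym {D} e , v , u) ◅ ε)

  -- A ray meets the pair of `o` at most twice, and away from that pair it cannot change sides. The
  -- time of the last visit is not computable, whence the double negation.
  climbs-somewhere : ∀ ray → ¬ ¬ ∃ λ d → Climbs d ray
  climbs-somewhere (r , r-inj , r-adj) never =
    visit 0 λ (a , _ , pa) → visit (suc a) λ (b , a<b , pb) → visit (suc b) λ (c , b<c , pc) →
      no-three a<b b<c (three-in-pair pa pb pc)
    where
    no-three : ∀ {a b c} → a < b → b < c → ¬ (r a ≡ r b ⊎ r a ≡ r c ⊎ r b ≡ r c)
    no-three a<b b<c (inj₁ eq) = ℕ.<⇒≢ a<b (r-inj eq)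
    no-three a<b b<c (inj₂ (inj₁ eq)) = ℕ.<⇒≢ (ℕ.<-trans a<b b<c) (r-inj eq)
    no-three a<b b<c (inj₂ (inj₂ eq)) = ℕ.<⇒≢ b<c (r-inj eq)
    visit : ∀ N → ¬ ¬ ∃ λ i → N ≤ i × InPair o (r i)
    visit N none = let d , h , p = level-total (r N) in never (d , N , λ i N≤i →
        let k , eq = ℕ.m≤n⇒∃[o]m+o≡n N≤i ; h , p = stays d (h , p) k in h , subst (λ j → Level d h (r j)) eq p)
      where
      stays : ∀ d → (∃ λ h → Level d h (r N)) → ∀ k → ∃ λ h → Level d h (r (N + k))
      stays d l zero rewrite ℕ.+-identityʳ N = l
      stays d l (suc k) rewrite ℕ.+-suc N k with stays d l k | UAdj⇒Dir {D} (r-adj (N + k))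
      ... | h , p | s , e with s Bool.≟ d
      ...   | yes refl = suc h , level-up d p e
      ...   | no s≢d rewrite Bool.¬-not s≢d with h
      ...     | zero = ⊥-elim (none (N + k , ℕ.m≤m+n N k , Level.pair p))
      ...     | suc h' = h' , level-down d p e

  contradiction : ⊥
  contradiction = let f , inequivalent = ends 3 in
    climbs-somewhere (f zero) λ (d₀ , c₀) → climbs-somewhere (f (suc zero)) λ (d₁ , c₁) →
    climbs-somewhere (f (suc (suc zero))) λ (d₂ , c₂) →
    decide f inequivalent d₀ d₁ d₂ c₀ c₁ c₂
    where
    decide : (f : Fin 3 → Ray D) → (∀ i j → i ≢ j → ¬ EquivRays D (f i) (f j)) → ∀ d₀ d₁ d₂ →
      Climbs d₀ (f zero) → Climbs d₁ (f (suc zero)) → Climbs d₂ (f (suc (suc zero))) → ⊥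
    decide f ineq d₀ d₁ d₂ c₀ c₁ c₂ with d₀ Bool.≟ d₁ | d₀ Bool.≟ d₂
    ... | yes refl | _ = ineq zero (suc zero) (λ ()) (equivalent d₀ (f zero) (f (suc zero)) c₀ c₁)
    ... | no _ | yes refl = ineq zero (suc (suc zero)) (λ ()) (equivalent d₀ (f zero) (f (suc (suc zero))) c₀ c₂)
    ... | no p | no q with trans (Bool.¬-not (λ eq → p (sym eq))) (sym (Bool.¬-not (λ eq → q (sym eq))))
    ...   | refl = ineq (suc zero) (suc (suc zero)) (λ ()) (equivalent d₁ (f (suc zero)) (f (suc (suc zero))) c₁ c₂)

-- Paths and detours

module Acyclicity {D : Graph} (S : Setting D)
    (twins-differ : ∀ x → Setting.twin S true x ≢ Setting.twin S false x)
    (no-triangle : ∀ d {x y z} → Dir D d x y → Dir D d y z → ¬ Dir D d z x) where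
  open Twins S

  private
    X = V D

  data Path (P : X → Set) : ℕ → X → X → Set where
    stop : ∀ {x} → P x → Path P 0 x x
    step : ∀ {k x y z} → P x → UAdj D x y → Path P k y z → Path P (suc k) x z

  module _ {P : X → Set} where

    path-start : ∀ {k x y} → Path P k x y → P x
    path-start (stop p) = p
    path-start (step p _ _) = p

    path-end : ∀ {k x y} → Path P k x y → P y
    path-end (stop p) = p
    path-end (step _ _ w) = path-end w

    append : ∀ {i j x y z} → Path P i x y → Path P j y z → Path P (i + j) x z
    append (stop _) w = w
    append (step p a v) w = step p a (append v w)

    extend : ∀ {k x y z} → Path P k x y → UAdj D y z → P z → Path P (suc k) x z
    extend (stop p) a q = step p a (stop q)
    extend (step p b w) a q = step p b (extend w a q)

    reverse-path : ∀ {k x y} → Path P k x y → Path P k y x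
    reverse-path (stop p) = stop p
    reverse-path (step p a w) = extend (reverse-path w) (UAdj-sym {D} a) p

    vertices : ∀ {k x y} → Path P k x y → List X
    vertices {x = x} (stop _) = x ∷ []
    vertices {x = x} (step _ _ w) = x ∷ vertices w

    start∈ : ∀ {k x y} (w : Path P k x y) → x ∈ vertices w
    start∈ (stop _) = here refl
    start∈ (step _ _ _) = here refl

    end∈ : ∀ {k x y} (w : Path P k x y) → y ∈ vertices w
    end∈ (stop _) = here refl
    end∈ (step _ _ w) = there (end∈ w)

    vertices-P : ∀ {k x y z} (w : Path P k x y) → z ∈ vertices w → P z
    vertices-P (stop p) (here refl) = p
    vertices-P (step p _ _) (here refl) = p
    vertices-P (step _ _ w) (there i) = vertices-P w i

    split : ∀ {k x y z} (w : Path P k x y) → z ∈ vertices w →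
      ∃ λ i → ∃ λ j → i + j ≡ k × Path P i x z × Path P j z y
    split (stop p) (here refl) = 0 , 0 , refl , stop p , stop p
    split w@(step p _ _) (here refl) = 0 , _ , refl , stop p , w
    split (step p a w) (there i) = let m , n , eq , u , v = split w i in
      suc m , n , cong suc eq , step p a u , v

  map-path : ∀ {P Q : X → Set} → (∀ {x} → P x → Q x) → ∀ {k x y} → Path P k x y → Path Q k x y
  map-path f (stop p) = stop (f p)
  map-path f (step p a w) = step (f p) a (map-path f w)

  Within : List X → X → X → Set
  Within F = Star (λ a b → b ∈ F × UAdj D a b)

  reverse-within : ∀ {F x y} → x ∈ F → Within F x y → Within F y x
  reverse-within x∈F ε = ε
  reverse-within x∈F ((z∈F , a) ◅ w) = reverse-within z∈F w ◅◅ ((x∈F , UAdj-sym {D} a) ◅ ε)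

  linked-from : ∀ {F x} → x ∈ F → (∀ {y} → y ∈ F → Within F x y) → Linked F
  linked-from x∈F w y∈F z∈F = reverse-within x∈F (w y∈F) ◅◅ w z∈F

  within-mono : ∀ {F G} → (∀ {z} → z ∈ F → z ∈ G) → ∀ {x y} → Within F x y → Within G x y
  within-mono F⊆G ε = ε
  within-mono F⊆G ((i , a) ◅ w) = (F⊆G i , a) ◅ within-mono F⊆G w

  path-within : ∀ {P k x y z} (w : Path P k x y) → z ∈ vertices w → Within (vertices w) x z
  path-within (stop _) (here refl) = ε
  path-within (step _ _ _) (here refl) = ε
  path-within (step _ a w) (there i) = (there (start∈ w) , a) ◅ within-mono there (path-within w i)

  Outside : X → X → Set
  Outside x y = ¬ Orb x y

  outside-cong : ∀ {x x'} → Orb x x' → ∀ {y} → Outside x y → Outside x' y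
  outside-cong o out p = out (Orb-trans o p)

  -- z is reached through the K₂,₂ of the d-edges at x by a path that does not
  -- return to the orbit of x.
  data Away (d : Bool) (x : X) (k : ℕ) (z : X) : Set where
    via : ∀ {y} → x —[ d ]→ y → Path (Outside x) k y z → Away d x k z

  away-start : ∀ d {x y} → x —[ d ]→ y → Away d x 0 y
  away-start d e = via e (stop (not-adjacent d e))

  away-outside : ∀ {d x k z} → Away d x k z → Outside x z
  away-outside (via _ w) = path-end w

  away-extend : ∀ {d x k y z} → Away d x k y → UAdj D y z → Outside x z → Away d x (suc k) z
  away-extend (via e w) a out = via e (extend w a out)

  away-append : ∀ {d x i j y z} → Away d x i y → Path (Outside x) j y z → Away d x (i + j) z
  away-append (via e w) v = via e (append w v)

  -- A path of length k + 2 that leaves the orbit of `from' and comes back to it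
  -- through a different K₂,₂.
  record Detour (k : ℕ) : Set where
    field
      {from to exit} : X
      d d' : Bool
      orbit : Orb from to
      away : Away d from k exit
      back : to —[ d' ]→ exit
      -- As an orbit contains no edge, the d-edges at `from` and the d'-edges at `to` belong to one
      -- K₂,₂ only in the excluded case.
      differ : ¬ (d ≡ d' × (to ≡ from ⊎ to ≡ twin d from))

  -- A detour that returns to its very starting vertex, entering in the direction in which it left
  -- and hence through the other K₂,₂ there.
  record ClosedDetour (k : ℕ) : Set where
    field
      {from exit} : X
      d : Bool
      away : Away d from k exit
      back : exit —[ d ]→ from

  closed⇒detour : ∀ {k} → ClosedDetour k → Detour k
  closed⇒detour c = record
    { d = d ; d' = not d ; orbit = here ; away = away ; back = flip-Dir d back
    ; differ = λ (d≡ , _) → Bool.not-¬ refl d≡ }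
    where open ClosedDetour c

  None< : ℕ → Set
  None< K = ∀ {k} → k < K → ¬ Detour k

  search : ∀ d b (F : List X) → (∃ λ v → v ∈ F × b —[ d ]→ v) ⊎ (∀ {v} → v ∈ F → ¬ b —[ d ]→ v)
  search d b F with any? (Dir? d b) F
  ... | yes p = inj₁ (find p)
  ... | no ¬p = inj₂ λ i e → ¬p (lose i e)

  module _ {k : ℕ} (none : None< k) where

    -- If the last vertex of a shortest detour had only its last edge into the
    -- detour, it could be swapped with its twin while the orbit of the first vertex
    -- is fixed.
    close : (δ : Detour k) → ClosedDetour k × (k ≡ 0 ⊎ Detour.d δ ≢ Detour.d' δ)
    close record { from = x ; to = b ; exit = y ; d = d ; d' = d' ; orbit = o ; away = via {x₁} e w ; back = back ; differ = differ } =
      decide (search (not d') b (vertices w)) (search (not d') (twin d' b) (vertices w))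
      where
      -- A second edge from b into the path closes it up at b. If it ends after the first vertex of
      -- the path, the result is a shorter detour; so it ends at that first vertex.
      hit : ∀ {b} → Orb x b → b —[ d' ]→ y → ¬ (d ≡ d' × (b ≡ x ⊎ b ≡ twin d x)) →
        (∃ λ v → v ∈ vertices w × b —[ not d' ]→ v) → ClosedDetour k × (k ≡ 0 ⊎ d ≢ d')
      hit {b} o back differ (v , v∈w , f) with split w v∈w
      ... | suc i , j , refl , _ , w' =
        ⊥-elim (none (s≤s (ℕ.m≤n+m j i)) (closed⇒detour record
          { d = not d' ; away = via f (map-path (outside-cong o) w') ; back = flip-Dir d' back }))
      ... | zero , j , refl , stop _ , w' = record
          { d = not d' ; away = via f (map-path (outside-cong o) w') ; back = flip-Dir d' back }
        , zero-or-differ j refl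
        where
        -- For d = d' and positive k, the first vertex of the path alone already gives a detour of
        -- length 0. This information is needed for the hexagon in `straight`.
        zero-or-differ : ∀ j → j ≡ k → j ≡ 0 ⊎ d ≢ d'
        zero-or-differ zero _ = inj₁ refl
        zero-or-differ (suc _) refl = inj₂ λ { refl → none (s≤s z≤n) record
          { d = d ; d' = not d ; orbit = o ; away = away-start d e ; back = f
          ; differ = λ (d≡ , _) → Bool.not-¬ refl d≡ } }
      b' = twin d' b
      o' : Orb x b'
      o' = o ∷twin d'
      back' : b' —[ d' ]→ y
      back' = twin-Dir d' back
      differ' : ¬ (d ≡ d' × (b' ≡ x ⊎ b' ≡ twin d x))
      differ' (refl , inj₁ refl) = differ (refl , inj₂ (sym (twin-involutive d b)))
      differ' (refl , inj₂ eq) = differ (refl , inj₁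
        (trans (sym (twin-involutive d b)) (trans (cong (twin d) eq) (twin-involutive d x))))
      F = x ∷ vertices w
      decide : _ → _ → ClosedDetour k × (k ≡ 0 ⊎ d ≢ d')
      decide (inj₁ h) _ = hit o back differ h
      decide (inj₂ _) (inj₁ h) = hit o' back' differ' h
      decide (inj₂ b-free) (inj₂ b'-free) =
        let g , fixes , moved = swap F linked b∉F b'∉F (there (end∈ w)) (UAdj-sym {D} (Dir⇒UAdj d' back)) agree
        in ⊥-elim (twin≢ d' b (trans (sym moved) (rigid g o (fixes (here refl)))))
        where
        linked : Linked F
        linked = linked-from (here refl) λ
          { (here refl) → ε
          ; (there i) → (there (start∈ w) , Dir⇒UAdj d e) ◅ within-mono there (path-within w i) }
        -- The end may coincide with x; then the first edge of the detour is itself an edge from it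
        -- into the path in the direction `not d'`.
        returns : ∀ {c} → c ≡ x → ¬ (d ≡ d' × (c ≡ x ⊎ c ≡ twin d x)) → c —[ not d' ]→ x₁
        returns refl dif with d Bool.≟ d'
        ... | yes d≡d' = ⊥-elim (dif (d≡d' , inj₁ refl))
        ... | no d≢d' = subst (λ s → x —[ s ]→ x₁) (Bool.¬-not d≢d') e
        b∉F : b ∉ F
        b∉F (here eq) = b-free (start∈ w) (returns eq differ)
        b∉F (there i) = vertices-P w i o
        b'∉F : b' ∉ F
        b'∉F (here eq) = b'-free (start∈ w) (returns eq differ')
        b'∉F (there i) = vertices-P w i o'
        agree : ∀ s {z} → z ∈ F → b —[ s ]→ z ⇔ b' —[ s ]→ z
        agree s (here refl) = mk⇔ (λ f → ⊥-elim (not-adjacent s f (Orb-sym o))) (λ f → ⊥-elim (not-adjacent s f (Orb-sym o')))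
        agree s (there i) with s Bool.≟ d'
        ... | yes refl = mk⇔ (twin-Dir d') (untwin-Dir d')
        ... | no s≢d' rewrite Bool.¬-not s≢d' = mk⇔ (λ f → ⊥-elim (b-free i f)) (λ f → ⊥-elim (b'-free i f))

  -- Directed paths and shortest closed detours

  data Directed (d : Bool) (x : X) : ℕ → X → Set where
    start : Directed d x 0 x
    _▷_ : ∀ {k y z} → Directed d x k y → y —[ d ]→ z → Directed d x (suc k) z

  directed-vertices : ∀ {d x k y} → Directed d x k y → List X
  directed-vertices {y = y} start = y ∷ []
  directed-vertices {y = z} (w ▷ _) = z ∷ directed-vertices w

  directed-start∈ : ∀ {d x k y} (w : Directed d x k y) → x ∈ directed-vertices w
  directed-start∈ start = here refl
  directed-start∈ (w ▷ _) = there (directed-start∈ w)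

  directed-end∈ : ∀ {d x k y} (w : Directed d x k y) → y ∈ directed-vertices w
  directed-end∈ start = here refl
  directed-end∈ (w ▷ _) = here refl

  directed-within : ∀ {d x k y z} (w : Directed d x k y) → z ∈ directed-vertices w → Within (directed-vertices w) y z
  directed-within start (here refl) = ε
  directed-within (w ▷ e) (here refl) = ε
  directed-within {d} (w ▷ e) (there i) =
    (there (directed-end∈ w) , UAdj-sym {D} (Dir⇒UAdj d e)) ◅ within-mono there (directed-within w i)

  directed-suffix : ∀ {d x k y z} (w : Directed d x k y) → z ∈ directed-vertices w →
    ∃ λ l → l ≤ k × Directed d z l y
  directed-suffix start (here refl) = 0 , z≤n , start
  directed-suffix (w ▷ e) (here refl) = 0 , z≤n , start
  directed-suffix (w ▷ e) (there i) = let l , l≤k , v = directed-suffix w i in suc l , s≤s l≤k , v ▷ e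

  module _ {k : ℕ} (none : None< k) where

    -- A directed path coming back to the orbit of x would arrive in the direction in which it left,
    -- hence through a different K₂,₂, and form a shorter detour.
    directed-away : ∀ {d x l y} → Directed d x (suc l) y → l ≤ k → Away d x l y
    directed-away {d} (start ▷ e) _ = away-start d e
    directed-away {d} (w@(_ ▷ _) ▷ e) l<k =
      let a = directed-away w (ℕ.<⇒≤ l<k) in
      away-extend a (Dir⇒UAdj d e) λ o → none l<k record
        { d = d ; d' = not d ; orbit = o ; away = a ; back = flip-Dir d e
        ; differ = λ (d≡ , _) → Bool.not-¬ refl d≡ }

    no-directed-cycle : ∀ {d x l} → Directed d x (suc l) x → ¬ l ≤ k
    no-directed-cycle w l≤k = away-outside (directed-away w l≤k) here

    module _ {d p i c} (w : Directed d p i c) {β} (e : c —[ d ]→ β) where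

      new-vertex : i ≤ k → β ∉ directed-vertices w
      new-vertex i≤k β∈w = let l , l≤i , v = directed-suffix w β∈w in
        no-directed-cycle (v ▷ e) (ℕ.≤-trans l≤i i≤k)

      no-back-edge : i < k → ∀ {z} → z ∈ directed-vertices w → ¬ β —[ d ]→ z
      no-back-edge i<k z∈w f = let l , l≤i , v = directed-suffix w z∈w in
        no-directed-cycle ((v ▷ e) ▷ f) (ℕ.≤-trans (s≤s l≤i) i<k)

    -- The closed detour is a directed cycle. Unless it is a triangle, fixing the path from p to c
    -- and moving b to its twin b' turns u into some z with b' → z → p in direction d. Then b, u, p,
    -- z, b' is a detour of length 2 with equal directions at its ends: minimality leaves only k =
    -- 2, and `close` rules out equal directions.
    straight : ∀ {d p i c b u} → Directed d p i c → c —[ d ]→ b → b —[ d ]→ u → u —[ d ]→ p → i + 1 ≡ k → ⊥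
    straight {d} start e f h _ = no-triangle d e f h
    straight {d} {p} {suc i} {c} {b} {u} w@(_ ▷ _) e f h i+2≡k =
      let g , fixes , moved = swap F linked (new-vertex w e i≤k) (new-vertex w (to-twin d e) i≤k)
            (directed-end∈ w) (Dir⇒UAdj d e) (agree-on d e λ c→β z∈F → no-back-edge w c→β i<k z∈F)
          b'→z = subst (λ v → v —[ d ]→ ⟦ g ⟧ u) moved (⟦⟧-Dir g d f)
          z→p = subst (⟦ g ⟧ u —[ d ]→_) (fixes (directed-start∈ w)) (⟦⟧-Dir g d h)
      in shorter (hexagon b'→z z→p)
      where
      F = directed-vertices w
      i<k : suc i < k
      i<k = ℕ.≤-reflexive (trans (ℕ.+-comm 1 (suc i)) i+2≡k)
      i≤k = ℕ.<⇒≤ i<k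
      linked : Linked F
      linked = linked-from (directed-end∈ w) (directed-within w)
      hexagon : ∀ {z} → twin (not d) b —[ d ]→ z → z —[ d ]→ p →
        Σ (Detour 2) λ δ → Detour.d δ ≡ Detour.d' δ
      hexagon b'→z z→p = record
        { d = d ; d' = d ; orbit = here ∷twin not d
        ; away = away-extend (away-extend (away-start d f) (Dir⇒UAdj d h) p-outside) (UAdj-sym {D} (Dir⇒UAdj d z→p)) z-outside
        ; back = b'→z
        ; differ = λ { (_ , inj₁ eq) → twin≢ (not d) b eq ; (_ , inj₂ eq) → differ-twin d eq } } , refl
        where
        p-outside : Outside b p
        p-outside o = away-outside (directed-away (w ▷ e) i≤k) (Orb-sym o)
        z-outside : Outside b _
        z-outside o = not-adjacent d b'→z (Orb-trans (Orb-twin (not d) b) o)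
        differ-twin : ∀ d → twin (not d) b ≢ twin d b
        differ-twin true eq = twins-differ b (sym eq)
        differ-twin false eq = twins-differ b eq
      shorter : Σ (Detour 2) (λ δ → Detour.d δ ≡ Detour.d' δ) → ⊥
      shorter (δ , same) with ℕ.m≤n⇒m<n∨m≡n (ℕ.≤-trans (s≤s (s≤s z≤n)) i<k)
      ... | inj₁ 2<k = none 2<k δ
      ... | inj₂ refl with close none δ
      ...   | _ , inj₂ different = different same

    -- b can be swapped with its other twin while twin d b, later on the detour, is fixed.
    turning : ∀ {d p i c b j y} → Directed d p i c → c —[ d ]→ b → Path (Outside p) j (twin d b) y →
      y —[ d ]→ p → i + suc (suc j) ≡ k → ⊥
    turning {d} {p} {i} {c} {b} {j} {y} w e rest h size =
      let g , fixes , moved = swap F linked (β∉F e) (β∉F (to-twin d e)) (∈-++⁺ˡ (directed-end∈ w)) (Dir⇒UAdj d e)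
            (agree-on d e no-edge)
      in twin≢ (not d) b (trans (sym moved) (rigid g (Orb-twin d b) (fixes (∈-++⁺ʳ L (start∈ rest)))))
      where
      L = directed-vertices w
      -- The vertex between b and `twin d b` is left out, as b has an edge to it; F stays connected
      -- through the closing edge from y to p.
      F = L ++ vertices rest
      bound : ∀ {j'} → j' ≤ j → suc (suc (i + j')) ≤ k
      bound {j'} j'≤j = ℕ.≤-trans (s≤s (s≤s (ℕ.+-monoʳ-≤ i j'≤j)))
        (ℕ.≤-reflexive (trans (sym (trans (ℕ.+-suc i (suc j)) (cong suc (ℕ.+-suc i j)))) size))
      i<k : i < k
      i<k = ℕ.≤-trans (s≤s (ℕ.m≤m+n i j)) (ℕ.≤-trans (ℕ.n≤1+n _) (bound ℕ.≤-refl))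
      part≤ : ∀ {m n} → m + n ≡ j → n ≤ j
      part≤ {m} {n} refl = ℕ.m≤n+m n m
      no-edge : ∀ {β z} → c —[ d ]→ β → z ∈ F → ¬ β —[ d ]→ z
      no-edge c→β z∈F f with ∈-++⁻ L z∈F
      ... | inj₁ z∈L = no-back-edge w c→β i<k z∈L f
      ... | inj₂ z∈rest = let m , n , eq , _ , v = split rest z∈rest in
        none (bound (part≤ {m} eq)) (closed⇒detour record
          { d = d ; back = h
          ; away = away-append (away-extend (directed-away (w ▷ c→β) (ℕ.<⇒≤ i<k)) (Dir⇒UAdj d f) (path-start v)) v })
      β∉F : ∀ {β} → c —[ d ]→ β → β ∉ F
      β∉F c→β β∈F with ∈-++⁻ L β∈F
      ... | inj₁ β∈L = new-vertex w c→β (ℕ.<⇒≤ i<k) β∈L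
      ... | inj₂ β∈rest = let m , n , eq , _ , v = split rest β∈rest in
        none (ℕ.<⇒≤ (bound (part≤ {m} eq))) (closed⇒detour record
          { d = d ; back = h ; away = away-append (directed-away (w ▷ c→β) (ℕ.<⇒≤ i<k)) v })
      c∈F = ∈-++⁺ˡ {xs = L} {ys = vertices rest} (directed-end∈ w)
      linked : Linked F
      linked = linked-from c∈F reach
        where
        to-rest : Within F c y
        to-rest = within-mono ∈-++⁺ˡ (directed-within w (directed-start∈ w))
                  ◅◅ ((∈-++⁺ʳ L (end∈ rest) , UAdj-sym {D} (Dir⇒UAdj d h)) ◅ ε)
        reach : ∀ {z} → z ∈ F → Within F c z
        reach z∈F with ∈-++⁻ L z∈F
        ... | inj₁ z∈L = within-mono ∈-++⁺ˡ (directed-within w z∈L)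
        ... | inj₂ z∈rest = to-rest
          ◅◅ within-mono (∈-++⁺ʳ L) (reverse-within (start∈ rest) (path-within rest (end∈ rest)) ◅◅ path-within rest z∈rest)

    -- Follows the detour up to its first edge against direction d. That edge leads back to b, which
    -- allows a shortcut, or to `twin d b`; with no such edge the detour is a directed cycle.
    traverse : ∀ {d p i c b u j y} → Directed d p i c → c —[ d ]→ b → b —[ d ]→ u →
      Path (Outside p) j u y → y —[ d ]→ p → i + suc j ≡ k → ⊥
    traverse w e f (stop _) h size = straight w e f h size
    traverse {d} {p} {i} {b = b} {u} {suc j} {y} w e f (step {y = v} _ a rest) h size
      with UAdj⇒Dir a
    ... | s , a' with s Bool.≟ d
    ...   | yes refl = traverse (w ▷ e) f a' rest h (trans (sym (ℕ.+-suc i (suc j))) size)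
    ...   | no s≢d rewrite Bool.¬-not s≢d = backwards rest (only-twin d f (unflip-Dir d a'))
      where
      i+j<k : i + j < k
      i+j<k = ℕ.≤-trans (ℕ.n≤1+n _) (ℕ.≤-reflexive (trans (sym (trans (ℕ.+-suc i (suc j)) (cong suc (ℕ.+-suc i j)))) size))
      backwards : ∀ {v} → Path (Outside p) j v y → v ≡ b ⊎ v ≡ twin d b → ⊥
      backwards rest (inj₁ refl) = none i+j<k (closed⇒detour record
        { d = d ; back = h
        ; away = away-append (directed-away (w ▷ e) (ℕ.≤-trans (ℕ.m≤m+n i j) (ℕ.<⇒≤ i+j<k))) rest })
      backwards rest (inj₂ refl) = turning w e rest h size

    no-closed : ¬ ClosedDetour k
    no-closed record { d = d ; away = via e (stop _) ; back = h } = asym d e h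
    no-closed record { d = d ; away = via e (step _ a rest) ; back = h } with UAdj⇒Dir a
    ... | s , a' with s Bool.≟ d
    ...   | yes refl = traverse {d} start e a' rest h refl
    ...   | no s≢d rewrite Bool.¬-not s≢d with only-twin d e (unflip-Dir d a')
    ...     | inj₁ refl = path-start rest here
    ...     | inj₂ refl = path-start rest (here ∷twin d)

  no-detour : ∀ k → ¬ Detour k
  no-detour = <-rec _ λ k none δ → no-closed (λ {l} → none {l}) (proj₁ (close (λ {l} → none {l}) δ))

  -- Tree-like separation at an orbit

  Beyond : Bool → X → X → Set
  Beyond d x z = ∃ λ k → Away d x k z

  beyond-outside : ∀ {d x z} → Beyond d x z → Outside x z
  beyond-outside (_ , a) = away-outside a

  in-pair? : ∀ d x y → Dec (y ≡ x ⊎ y ≡ twin d x)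
  in-pair? d x y = (y ≟ x) ⊎-dec (y ≟ twin d x)

  in-pair⇒Orb : ∀ {d x y} → y ≡ x ⊎ y ≡ twin d x → Orb x y
  in-pair⇒Orb (inj₁ refl) = here
  in-pair⇒Orb (inj₂ refl) = here ∷twin _

  in-pair-Dir : ∀ d {x y z} → y ≡ x ⊎ y ≡ twin d x → y —[ d ]→ z → x —[ d ]→ z
  in-pair-Dir d (inj₁ refl) e = e
  in-pair-Dir d (inj₂ refl) e = untwin-Dir d e

  return : ∀ {d x k z} d' {y} → Away d x k z → Orb x y → y —[ d' ]→ z → d ≡ d' × (y ≡ x ⊎ y ≡ twin d x)
  return {d} {x} {k} {z} d' {y} a o e with d Bool.≟ d' | in-pair? d x y
  ... | yes d≡d' | yes p = d≡d' , p
  ... | no d≢d' | _ = ⊥-elim (no-detour k record { d = d ; d' = d' ; orbit = o ; away = a ; back = e ; differ = λ (eq , _) → d≢d' eq })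
  ... | yes _ | no ¬p = ⊥-elim (no-detour k record { d = d ; d' = d' ; orbit = o ; away = a ; back = e ; differ = λ (_ , p) → ¬p p })

  beyond-step : ∀ {d x y z} → Beyond d x y → UAdj D y z →
    Beyond d x z ⊎ ((z ≡ x ⊎ z ≡ twin d x) × z —[ d ]→ y)
  beyond-step {d} {x} {y} {z} (k , a) e with in-pair? d x z | UAdj⇒Dir {D} (UAdj-sym {D} e)
  ... | yes p | d' , f with return d' a (in-pair⇒Orb p) f
  ...   | refl , _ = inj₂ (p , f)
  beyond-step {d} {x} {y} {z} (k , a) e | no ¬p | d' , f =
    inj₁ (suc k , away-extend a e λ o → ¬p (proj₂ (return d' a o f)))

  -- A vertex and its twin are two steps apart. If the vertex between them lies in the orbit of x,
  -- both are d-neighbours of x.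
  beyond-twin : ∀ {d x z} → Beyond d x z → ∀ d' → Beyond d x (twin d' z)
  beyond-twin {d} {x} {z} a d' with beyond-step a (Dir⇒UAdj d' (nbr-Dir d' z))
  ... | inj₁ a' with beyond-step a' (UAdj-sym {D} (Dir⇒UAdj d' (twin-Dir d' (nbr-Dir d' z))))
  ...   | inj₁ a″ = a″
  ...   | inj₂ (p , _) = ⊥-elim (beyond-outside a (Orb-trans (in-pair⇒Orb p) (Orb-twin d' z)))
  beyond-twin {d} {x} {z} a d' | inj₂ (p , e) with d' Bool.≟ d
  ...   | yes refl = ⊥-elim (asym d' (nbr-Dir d' z) e)
  ...   | no d'≢d rewrite Bool.¬-not d'≢d = 0 , away-start d (in-pair-Dir d p (to-twin d e))

  beyond-Orb : ∀ {d x y z} → Beyond d x y → Orb y z → Beyond d x z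
  beyond-Orb a here = a
  beyond-Orb a (o ∷twin d') = beyond-twin (beyond-Orb a o) d'

  -- One path to z followed by the reverse of the other returns to the orbit, so both use the same
  -- K₂,₂.
  beyond-disjoint : ∀ {d x d' y z} → Beyond d x z → Beyond d' y z → Orb x y → d ≡ d' × (y ≡ x ⊎ y ≡ twin d x)
  beyond-disjoint {d' = d'} (_ , a) (_ , via {_} e w) o =
    return d' (away-append a (reverse-path (map-path (outside-cong (Orb-sym o)) w))) o e

  -- Rotation of an orbit and its period

  rotate : ℕ → X → X
  rotate zero x = x
  rotate (suc k) x = twin false (twin true (rotate k x))

  rotate-+ : ∀ i j x → rotate (i + j) x ≡ rotate i (rotate j x)
  rotate-+ zero j x = refl
  rotate-+ (suc i) j x = cong (λ y → twin false (twin true y)) (rotate-+ i j x)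

  rotate-suc : ∀ k x → rotate (suc k) x ≡ rotate k (twin false (twin true x))
  rotate-suc k x = trans (cong (λ n → rotate n x) (ℕ.+-comm 1 k)) (rotate-+ k 1 x)

  twin-injective : ∀ d {x y} → twin d x ≡ twin d y → x ≡ y
  twin-injective d {x} {y} eq = trans (sym (twin-involutive d x)) (trans (cong (twin d) eq) (twin-involutive d y))

  rotate-injective : ∀ k {x y} → rotate k x ≡ rotate k y → x ≡ y
  rotate-injective zero eq = eq
  rotate-injective (suc k) eq = rotate-injective k (twin-injective true (twin-injective false eq))

  rotate-Orb : ∀ k x → Orb x (rotate k x)
  rotate-Orb zero x = here
  rotate-Orb (suc k) x = (rotate-Orb k x ∷twin true) ∷twin false

  ⟦⟧-rotate : ∀ g k x → ⟦ g ⟧ (rotate k x) ≡ rotate k (⟦ g ⟧ x)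
  ⟦⟧-rotate g zero x = refl
  ⟦⟧-rotate g (suc k) x = trans (⟦⟧-twin g false _) (cong (twin false)
    (trans (⟦⟧-twin g true _) (cong (twin true) (⟦⟧-rotate g k x))))

  -- Replacing x by τ⁻τ⁺x lowers k by 2, until k is 0 or 1 and τ⁺ or τ⁻ would have a fixed point.
  rotate≢twin : ∀ k x → rotate k x ≢ twin true x
  rotate≢twin 0 x eq = twin≢ true x (sym eq)
  rotate≢twin 1 x eq = twin≢ false (twin true x) eq
  rotate≢twin (suc (suc k)) x eq = rotate≢twin k (twin false (twin true x))
    (trans (sym (rotate-suc k x))
      (trans (sym (twin-involutive true _)) (cong (twin true) (trans (sym (twin-involutive false _)) (cong (twin false) eq)))))

  around : X → ℕ → X
  around x zero = x
  around x (suc j) = twin (not (odd j)) (around x j)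

  around-Orb : ∀ x j → Orb x (around x j)
  around-Orb x zero = here
  around-Orb x (suc j) = around-Orb x j ∷twin _

  around-parity : ∀ x j → (odd j ≡ false × ∃ λ k → around x j ≡ rotate k x)
                        ⊎ (odd j ≡ true × ∃ λ k → around x j ≡ twin true (rotate k x))
  around-parity x zero = inj₁ (refl , 0 , refl)
  around-parity x (suc j) with around-parity x j
  ... | inj₁ (even , k , eq) rewrite even = inj₂ (refl , k , cong (twin true) eq)
  ... | inj₂ (isodd , k , eq) rewrite isodd = inj₁ (refl , suc k , cong (twin false) eq)

  -- The invariant of a walk from τ⁺x that avoids x. Such a walk can pass from one orbit vertex only
  -- to a twin of it, one place forwards or backwards, and from the first place backwards only to x.
  Reached : X → X → Set
  Reached x w = ∃ λ j → w ≡ around x (suc j) ⊎ ∃ λ d → Beyond d (around x (suc j)) w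

  reached-step : ∀ {x y z} → Reached x y → UAdj D y z → z ≢ x → Reached x z
  reached-step (j , inj₁ refl) e _ = let d , e' = UAdj⇒Dir {D} e in j , inj₂ (d , 0 , away-start d e')
  reached-step {x} {y} {z} (j , inj₂ (d , a)) e z≢x with beyond-step a e
  ... | inj₁ a' = j , inj₂ (d , a')
  ... | inj₂ (inj₁ refl , _) = j , inj₁ refl
  ... | inj₂ (inj₂ refl , _) with d Bool.≟ not (odd j)
  ...   | no d≢ = suc j , inj₁ (cong (λ s → twin s (around x (suc j))) (Bool.¬-not d≢))
  ...   | yes refl = backwards j z≢x
    where
    backwards : ∀ j → twin (not (odd j)) (around x (suc j)) ≢ x → Reached x (twin (not (odd j)) (around x (suc j)))
    backwards zero ne = ⊥-elim (ne (twin-involutive true x))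
    backwards (suc j) ne = j , inj₁ (twin-involutive (not (odd (suc j))) _)

  reached : ∀ {x y z} → Reached x y → Star (λ a b → UAdj D a b × a ≢ x × b ≢ x) y z → Reached x z
  reached r ε = r
  reached r ((e , _ , z≢x) ◅ w) = reached (reached-step r e z≢x) w

  -- The end τ⁻x is in the orbit, so it is some `around x (suc j)`. An even number of twin steps
  -- would make a twin of x a rotation of x; an odd number, with τ⁻ applied once more, closes the
  -- cycle.
  periodic : ∀ x → Star (λ a b → UAdj D a b × a ≢ x × b ≢ x) (twin true x) (twin false x) →
    ∃ λ k → rotate (suc k) x ≡ x
  periodic x w with reached (0 , inj₁ refl) w
  ... | j , inj₂ (d , a) = ⊥-elim (beyond-outside a (Orb-trans (Orb-sym (around-Orb x (suc j))) (here ∷twin false)))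
  ... | j , inj₁ eq with around-parity x (suc j)
  ...   | inj₂ (_ , k , eq') = k , trans (cong (twin false) (trans (sym eq') (sym eq))) (twin-involutive false x)
  ...   | inj₁ (_ , zero , eq') = ⊥-elim (twin≢ false x (trans eq eq'))
  ...   | inj₁ (_ , suc k , eq') =
    ⊥-elim (rotate≢twin k x (trans (sym (twin-involutive true _)) (cong (twin true) (sym (twin-injective false (trans eq eq'))))))

  -- The period meant is `suc m`.
  LeastPeriod : ℕ → X → Set
  LeastPeriod m x = rotate (suc m) x ≡ x × (∀ j → j < m → rotate (suc j) x ≢ x)

  least-period : ∀ k x → rotate (suc k) x ≡ x → ∃ λ m → LeastPeriod m x
  least-period = <-rec _ λ k rec x eq → search-below k rec x eq
    where
    search-below : ∀ k → (∀ {j} → j < k → ∀ x → rotate (suc j) x ≡ x → ∃ λ m → LeastPeriod m x) →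
      ∀ x → rotate (suc k) x ≡ x → ∃ λ m → LeastPeriod m x
    search-below k rec x eq with Fin.any? {k} (λ j → rotate (suc (Fin.toℕ j)) x ≟ x)
    ... | yes (j , eq') = rec (Fin.toℕ<n j) x eq'
    ... | no none = k , eq , λ j j<k eq' → none (Fin.fromℕ< j<k ,
      subst (λ n → rotate (suc n) x ≡ x) (sym (Fin.toℕ-fromℕ< j<k)) eq')

  least-period-everywhere : ∀ {m x} → LeastPeriod m x → ∀ y → LeastPeriod m y
  least-period-everywhere {m} {x} (period , least) y =
    transport x y (suc m) period , λ j j<m eq → least j j<m (transport y x (suc j) eq)
    where
    transport : ∀ x y k → rotate k x ≡ x → rotate k y ≡ y
    transport x y k eq with transitive homogeneous loopless x y
    ... | g , refl = trans (sym (⟦⟧-rotate g k x)) (cong ⟦ g ⟧ eq)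

-- Words and labels

-- Words carry their latest move in front, so the common suffix c is the vertex at which the tree
-- paths from the root part.
data Overlap {A : Set} : List A → List A → Set where
  same : ∀ {u} → Overlap u u
  longer : ∀ w x c → Overlap (w ++ x ∷ c) c
  shorter : ∀ w x c → Overlap c (w ++ x ∷ c)
  fork : ∀ w x w' x' c → x ≢ x' → Overlap (w ++ x ∷ c) (w' ++ x' ∷ c)

overlap-∷ʳ : ∀ {A : Set} {u v : List A} → Overlap u v → ∀ z → Overlap (u ∷ʳ z) (v ∷ʳ z)
overlap-∷ʳ same z = same
overlap-∷ʳ (longer w x c) z rewrite List.++-assoc w (x ∷ c) (z ∷ []) = longer w x (c ∷ʳ z)
overlap-∷ʳ (shorter w x c) z rewrite List.++-assoc w (x ∷ c) (z ∷ []) = shorter w x (c ∷ʳ z)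
overlap-∷ʳ (fork w x w' x' c ne) z
  rewrite List.++-assoc w (x ∷ c) (z ∷ []) | List.++-assoc w' (x' ∷ c) (z ∷ []) = fork w x w' x' (c ∷ʳ z) ne

overlaps : ∀ {A : Set} → DecidableEquality A → (u v : List A) → Overlap u v
overlaps {A} _≟_ u v = go (reverseView u) (reverseView v)
  where
  go : ∀ {u v} → Reverse u → Reverse v → Overlap u v
  go [] [] = same
  go [] (ys ∶ _ ∶ʳ y) = shorter ys y []
  go (xs ∶ _ ∶ʳ x) [] = longer xs x []
  go (xs ∶ r ∶ʳ x) (ys ∶ s ∶ʳ y) with x ≟ y
  ... | yes refl = overlap-∷ʳ (go r s) x
  ... | no x≢y = fork xs x ys y [] x≢y

sucMod-surjective : ∀ {m} (i : Fin m) → ∃ λ j → sucMod j ≡ i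
sucMod-surjective {suc n} zero = Fin.fromℕ n , Fin.toℕ-injective (trans (Fin.toℕ-fromℕ< _)
  (trans (cong (λ k → suc k % suc n) (Fin.toℕ-fromℕ n)) (ℕ.n%n≡0 (suc n))))
sucMod-surjective {suc n} (suc i) = Fin.inject₁ i , Fin.toℕ-injective (trans (Fin.toℕ-fromℕ< _)
  (trans (cong (λ k → suc k % suc n) (Fin.toℕ-inject₁ i)) (ℕ.m<n⇒m%n≡m (s≤s (Fin.toℕ<n i)))))

isPartner-not : ∀ {m} (i : Fin m) b → isPartner (i , b) (i , not b) ≡ true
isPartner-not i b with i Fin.≟ i
isPartner-not i true | yes _ = refl
isPartner-not i false | yes _ = refl
... | no i≢i = ⊥-elim (i≢i refl)

isPartner⇒ : ∀ {m} {i : Fin m} {b j c} → isPartner (i , b) (j , c) ≡ true → j ≡ i × c ≡ not b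
isPartner⇒ {i = i} {b} {j} {c} eq with i Fin.≟ j
isPartner⇒ {b = true} {c = false} eq | yes refl = refl , refl
isPartner⇒ {b = false} {c = true} eq | yes refl = refl , refl

reduced-tail : ∀ {m} (x : Lab m) u → reduced (x ∷ u) ≡ true → reduced u ≡ true
reduced-tail x [] _ = refl
reduced-tail x (y ∷ u) red with isPartner x y
... | false = red

reduced-head : ∀ {m} (x y : Lab m) u → reduced (x ∷ y ∷ u) ≡ true → isPartner x y ≢ true
reduced-head x y u red partner rewrite partner with () ← red

move-reduced : ∀ {m} (u : List (Lab m)) l → reduced u ≡ true → reduced (move u l) ≡ true
move-reduced [] l _ = refl
move-reduced (y ∷ u) l red with isPartner l y in eq
... | true = reduced-tail y u red
... | false rewrite eq = red

-- Labelling the vertices by reduced words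

module Labelling {D : Graph} (S : Setting D)
    (twins-differ : ∀ x → Setting.twin S true x ≢ Setting.twin S false x)
    (no-triangle : ∀ d {x y z} → Dir D d x y → Dir D d y z → ¬ Dir D d z x) where
  open Twins S
  open Acyclicity S twins-differ no-triangle

  private
    X = V D

  module _ (n : ℕ) (least : ∀ x → LeastPeriod n x) where

    m : ℕ
    m = suc n

    rotate-m : ∀ x → rotate m x ≡ x
    rotate-m x = proj₁ (least x)

    rotate-*m : ∀ k x → rotate (k * m) x ≡ x
    rotate-*m zero x = refl
    rotate-*m (suc k) x = trans (rotate-+ m (k * m) x) (trans (rotate-m _) (rotate-*m k x))

    rotate-% : ∀ k x → rotate (k % m) x ≡ rotate k x
    rotate-% k x = sym (trans (cong (λ l → rotate l x) (ℕ.m≡m%n+[m/n]*n k m))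
      (trans (rotate-+ (k % m) (k / m * m) x) (cong (rotate (k % m)) (rotate-*m (k / m) x))))

    rotate-< : ∀ {i j x} → i < j → j < m → rotate i x ≢ rotate j x
    rotate-< {i} {j} {x} i<j j<m eq with ℕ.m≤n⇒∃[o]m+o≡n i<j
    ... | k , refl = proj₂ (least x) k (ℕ.≤-trans (s≤s (ℕ.m≤n+m k i)) (ℕ.≤-pred j<m))
      (rotate-injective i (trans (trans (sym (rotate-+ i (suc k) x))
        (cong (λ l → rotate l x) (ℕ.+-suc i k))) (sym eq)))

    -- x is the vertex with label (0 , false) of its orbit
    place : X → Lab m → X
    place x (i , false) = rotate (Fin.toℕ i) x
    place x (i , true) = twin true (rotate (Fin.toℕ i) x)

    rotate-toℕ-injective : ∀ {i j : Fin m} {x} → rotate (Fin.toℕ i) x ≡ rotate (Fin.toℕ j) x → i ≡ j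
    rotate-toℕ-injective {i} {j} eq with Fin.<-cmp i j
    ... | tri< i<j _ _ = ⊥-elim (rotate-< i<j (Fin.toℕ<n j) eq)
    ... | tri≈ _ i≡j _ = i≡j
    ... | tri> _ _ j<i = ⊥-elim (rotate-< j<i (Fin.toℕ<n i) (sym eq))

    -- The dihedral relation: τ⁺ conjugates a rotation into its inverse.
    rotate-twin : ∀ k x → rotate k (twin true (rotate k x)) ≡ twin true x
    rotate-twin zero x = refl
    rotate-twin (suc k) x = trans (rotate-suc k _)
      (trans (cong (λ y → rotate k (twin false y)) (twin-involutive true _))
      (trans (cong (rotate k) (twin-involutive false _)) (rotate-twin k x)))

    twin≢rotate : ∀ i j {x} → twin true (rotate i x) ≢ rotate j x
    twin≢rotate i j {x} eq = rotate≢twin (i + j) x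
      (trans (rotate-+ i j x) (trans (cong (rotate i) (sym eq)) (rotate-twin i x)))

    place-injective : ∀ x l l' → place x l ≡ place x l' → l ≡ l'
    place-injective x (i , false) (j , false) eq = cong (_, false) (rotate-toℕ-injective eq)
    place-injective x (i , true) (j , true) eq = cong (_, true) (rotate-toℕ-injective (twin-injective true eq))
    place-injective x (i , true) (j , false) eq = ⊥-elim (twin≢rotate (Fin.toℕ i) (Fin.toℕ j) eq)
    place-injective x (i , false) (j , true) eq = ⊥-elim (twin≢rotate (Fin.toℕ j) (Fin.toℕ i) (sym eq))

    -- The cyclic order of `M'` is τ⁺ and τ⁻ applied in turn, closing up by periodicity.
    place-cyc : ∀ x l → place x (cyc l) ≡ twin (not (proj₂ l)) (place x l)
    place-cyc x (i , false) = refl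
    place-cyc x (i , true) = trans (cong (λ k → rotate k x) sucMod≡) (rotate-% (suc (Fin.toℕ i)) x)
      where
      sucMod≡ : Fin.toℕ (sucMod i) ≡ suc (Fin.toℕ i) % m
      sucMod≡ = Fin.toℕ-fromℕ< _

    place-Orb : ∀ x l → Orb x (place x l)
    place-Orb x (i , false) = rotate-Orb (Fin.toℕ i) x
    place-Orb x (i , true) = rotate-Orb (Fin.toℕ i) x ∷twin true

    -- A label (i , c) names the K₂,₂ of the `not c`-edges at its place. The other orbit vertex on
    -- that side has a label of the other parity, so the name is unique.
    same-place : ∀ x i j c → place x (j , c) ≡ place x (i , c) ⊎ place x (j , c) ≡ twin (not c) (place x (i , c)) → j ≡ i
    same-place x i j c (inj₁ eq) = cong proj₁ (place-injective x (j , c) (i , c) eq)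
    same-place x i j false (inj₂ eq) with () ← place-injective x (j , false) (i , true) eq
    same-place x i j true (inj₂ eq)
      with () ← place-injective x (j , true) (cyc (i , true)) (trans eq (sym (place-cyc x (i , true))))

    unplace : Fin m → X → X
    unplace i y = rotate (m ∸ Fin.toℕ i) y

    place-unplace : ∀ i y → place (unplace i y) (i , false) ≡ y
    place-unplace i y = trans (sym (rotate-+ (Fin.toℕ i) _ y))
      (trans (cong (λ k → rotate k y) (ℕ.m+[n∸m]≡n (ℕ.<⇒≤ (Fin.toℕ<n i)))) (rotate-m y))

    -- The edge crossed along (i , b) must end at label (i , `not b`). An outward edge therefore
    -- ends at (i , true), the τ⁺-twin of (i , false), whence the additional twin; an inward edge
    -- ends at (i , false) itself.
    origin : List (Lab m) → X
    origin [] = base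
    origin ((i , false) ∷ u) = unplace i (twin true (nbr true (place (origin u) (i , false))))
    origin ((i , true) ∷ u) = unplace i (nbr false (place (origin u) (i , true)))

    at : List (Lab m) → Lab m → X
    at u l = place (origin u) l

    at-Orb : ∀ u l l' → Orb (at u l) (at u l')
    at-Orb u l l' = Orb-trans (Orb-sym (place-Orb (origin u) l)) (place-Orb (origin u) l')

    cross : ∀ u i b → at u (i , b) —[ not b ]→ at ((i , b) ∷ u) (i , not b)
    cross u i false = subst (at u (i , false) —[ true ]→_)
      (sym (trans (cong (twin true) (place-unplace i _)) (twin-involutive true _))) (nbr-Dir true _)
    cross u i true = subst (at u (i , true) —[ false ]→_) (sym (place-unplace i _)) (nbr-Dir false _)

    cross-move : ∀ u i b → at u (i , b) —[ not b ]→ at (move u (i , b)) (i , not b)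
    cross-move [] i b = cross [] i b
    cross-move ((j , c) ∷ u) i b with isPartner (i , b) (j , c) in eq
    ... | false = cross ((j , c) ∷ u) i b
    ... | true with isPartner⇒ {i = i} {b} {j} {c} eq
    cross-move ((j , c) ∷ u) i true | true | refl , refl = cross u i false
    cross-move ((j , c) ∷ u) i false | true | refl , refl = cross u i true

    -- Returning through the first K₂,₂ would need a move that cancels the first one. The bound k
    -- serves the recursion, which also drops letters at the far end of w.
    separated : ∀ k w {v i b} → length w ≤ k → reduced (w ++ (i , b) ∷ v) ≡ true → ∀ l →
      Beyond (not b) (at v (i , b)) (at (w ++ (i , b) ∷ v) l)
    separated k [] {v} {i} {b} _ _ l =
      beyond-Orb (0 , away-start (not b) (cross v i b)) (at-Orb ((i , b) ∷ v) (i , not b) l)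
    separated (suc k) ((j , c) ∷ w) {v} {i} {b} (s≤s w≤k) red l =
      onwards (beyond-step (separated (suc k) w (ℕ.m≤n⇒m≤1+n w≤k) red' (j , c)) (Dir⇒UAdj (not c) (cross u j c)))
      where
      u = w ++ (i , b) ∷ v
      red' : reduced u ≡ true
      red' = reduced-tail (j , c) u red
      x = at v (i , b)
      -- With w empty the move would be the inverse of (i , b), against reducedness. Otherwise the
      -- vertex before the move lies beyond the orbit at (i , b) ∷ v and cannot be in that orbit.
      blocked : ∀ {w} → Reverse w → length w ≤ k → reduced ((j , c) ∷ w ++ (i , b) ∷ v) ≡ true → c ≡ not b →
        let z = at (w ++ (i , b) ∷ v) (j , c) ; z₁ = at ((i , b) ∷ v) (i , not b) in
        ¬ (z ≡ z₁ ⊎ z ≡ twin (not (not b)) z₁)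
      blocked [] _ red refl p with same-place (origin ((i , b) ∷ v)) i j (not b) p
      ... | refl = reduced-head (i , not b) (i , b) v red
        (subst (λ s → isPartner (i , not b) (i , s) ≡ true) (Bool.not-involutive b) (isPartner-not i (not b)))
      blocked (w ∶ _ ∶ʳ l₂) w≤k red _ p =
        beyond-outside (separated k w (ℕ.≤-trans (ℕ.≤-trans (ℕ.m≤m+n _ _) (ℕ.≤-reflexive (sym (List.length-++ w)))) w≤k)
            (subst (λ t → reduced t ≡ true) (List.++-assoc w (l₂ ∷ []) _)
              (reduced-tail (j , c) ((w ∷ʳ l₂) ++ (i , b) ∷ v) red)) (j , c))
          (subst (λ t → Orb (at ((i , b) ∷ v) l₂) (at t (j , c))) (List.++-assoc w (l₂ ∷ []) _)
            (Orb-trans (at-Orb ((i , b) ∷ v) l₂ (i , not b)) (in-pair⇒Orb p)))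
      onwards : _ → Beyond (not b) x (at ((j , c) ∷ u) l)
      onwards (inj₁ a) = beyond-Orb a (at-Orb ((j , c) ∷ u) (j , not c) l)
      onwards (inj₂ (p , e)) with c Bool.≟ not b
      ... | yes c≡ = ⊥-elim (blocked (reverseView w) w≤k red c≡
              (target-twin (not b) (cross v i b) (in-pair-Dir (not b) p e)))
      ... | no c≢ = ⊥-elim (asym (not b) e (subst (λ s → at u (j , c) —[ not s ]→ at ((j , c) ∷ u) (j , not c))
              (trans (Bool.¬-not c≢) (Bool.not-involutive b)) (cross u j c)))

    -- If one tree path extends the other, its vertices lie outside the earlier orbit; if the paths
    -- fork, they leave the last common orbit through different copies of K₂,₂.
    at-injective₁ : ∀ {u v} → reduced u ≡ true → reduced v ≡ true → ∀ l k → at u l ≡ at v k → u ≡ v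
    at-injective₁ {u} {v} red-u red-v l k eq with overlaps (Prod.≡-dec Fin._≟_ Bool._≟_) u v
    ... | same = refl
    ... | longer w x c = ⊥-elim (beyond-outside (separated _ w ℕ.≤-refl red-u l)
            (subst (Orb (at c x)) (sym eq) (at-Orb c x k)))
    ... | shorter w x c = ⊥-elim (beyond-outside (separated _ w ℕ.≤-refl red-v k)
            (subst (Orb (at c x)) eq (at-Orb c x l)))
    ... | fork w x w' x' c x≢x' = ⊥-elim (distinct (beyond-disjoint
            (subst (Beyond _ (at c x)) eq (separated _ w ℕ.≤-refl red-u l)) (separated _ w' ℕ.≤-refl red-v k) (at-Orb c x x')) x≢x')
      where
      distinct : ∀ {i b j c'} {o : X} →
        not b ≡ not c' × (place o (j , c') ≡ place o (i , b) ⊎ place o (j , c') ≡ twin (not b) (place o (i , b))) →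
        (i , b) ≢ (j , c') → ⊥
      distinct {b = b} (nb≡nc , p) ne with Bool.not-injective nb≡nc
      ... | refl = ne (cong (_, b) (sym (same-place _ _ _ b p)))

    position : V (M' m) → X
    position ((u , _) , l) = at u l

    position-injective : ∀ p q → position p ≡ position q → p ≡ q
    position-injective ((u , r) , l) ((v , s) , k) eq with at-injective₁ {u} {v} r s l k eq
    ... | refl = cong₂ (λ r l → ((u , r) , l)) (Decidable⇒UIP.≡-irrelevant Bool._≟_ r s) (place-injective (origin u) l k eq)

    moved : UVert m → Lab m → UVert m
    moved (u , r) l = move u l , move-reduced u l r

    out-of : ∀ (u : UVert m) i b {y} → at (proj₁ u) (i , b) —[ true ]→ y →
      y ≡ at (move (proj₁ u) (i , false)) (i , true) ⊎ y ≡ at (move (proj₁ u) (i , false)) (cyc (i , true))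
    out-of (u , _) i false e with target-twin true (cross-move u i false) e
    ... | inj₁ eq = inj₁ eq
    ... | inj₂ eq = inj₂ (trans eq (sym (place-cyc _ (i , true))))
    out-of u i true e = out-of u i false (untwin-Dir true e)

    into : ∀ (u : UVert m) i {y} → at (proj₁ u) (i , true) —[ false ]→ y → ∃ λ q → position q ≡ y
    into (u , r) i e with target-twin false (cross-move u i true) e
    ... | inj₁ eq = (moved (u , r) (i , true) , (i , false)) , sym eq
    ... | inj₂ eq = (moved (u , r) (i , true) , (i , true)) , sym eq

    position-closed : ∀ d p {y} → position p —[ d ]→ y → ∃ λ q → position q ≡ y
    position-closed true (u , i , b) e with out-of u i b e
    ... | inj₁ eq = (moved u (i , false) , (i , true)) , sym eq
    ... | inj₂ eq = (moved u (i , false) , cyc (i , true)) , sym eq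
    position-closed false (u , i , true) e = into u i e
    position-closed false (u , i , false) e with sucMod-surjective i
    ... | j , refl = into u j (untwin-Dir false (subst (_—[ false ]→ _) (place-cyc (origin (proj₁ u)) (j , true)) e))

    position-surjective : ∀ x → ∃ λ p → position p ≡ x
    position-surjective x = go (connected (position root) x) (root , refl)
      where
      root : V (M' m)
      root = ([] , refl) , (zero , false)
      go : ∀ {x y} → Star (UAdj D) x y → (∃ λ p → position p ≡ x) → ∃ λ p → position p ≡ y
      go ε r = r
      go (a ◅ w) (p , refl) = let d , e = UAdj⇒Dir {D} a in go w (position-closed d p e)

    M'-edge : ∀ p q → E (M' m) p q → E D (position p) (position q)
    M'-edge ((u , _) , l) ((v , _) , k) (i , refl , l∈ , k∈) = head k∈ (tail l∈)
      where
      v' = move u (i , false)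
      tail : l ≡ (i , false) ⊎ l ≡ (i , true) → at u l —[ true ]→ at v' (i , true)
      tail (inj₁ refl) = cross-move u i false
      tail (inj₂ refl) = twin-Dir true (cross-move u i false)
      head : ∀ {x} → k ≡ (i , true) ⊎ k ≡ cyc (i , true) → x —[ true ]→ at v' (i , true) → x —[ true ]→ at v' k
      head (inj₁ refl) e = e
      head (inj₂ refl) e = subst (_ —[ true ]→_) (sym (place-cyc (origin v') (i , true))) (to-twin true e)

    edge-M' : ∀ p q → E D (position p) (position q) → E (M' m) p q
    edge-M' p@((u , r) , (i , b)) q e = from (out-of (u , r) i b e)
      where
      v = moved (u , r) (i , false)
      label : ∀ b → (i , b) ≡ (i , false) ⊎ (i , b) ≡ (i , true)
      label false = inj₁ refl
      label true = inj₂ refl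
      from : position q ≡ at (proj₁ v) (i , true) ⊎ position q ≡ at (proj₁ v) (cyc (i , true)) → E (M' m) p q
      from (inj₁ eq) with position-injective q (v , (i , true)) eq
      ... | refl = i , refl , label b , inj₁ refl
      from (inj₂ eq) with position-injective q (v , cyc (i , true)) eq
      ... | refl = i , refl , label b , inj₂ refl

    iso : Iso D (M' m)
    iso = mk↔ₛ′ (λ x → proj₁ (position-surjective x)) position
            (λ p → position-injective _ p (proj₂ (position-surjective (position p))))
            (λ x → proj₂ (position-surjective x))
        , λ x y → let p , p≡x = position-surjective x ; q , q≡y = position-surjective y in
            mk⇔ (λ e → edge-M' p q (subst₂ (E D) (sym p≡x) (sym q≡y) e))
                (λ e → subst₂ (E D) p≡x q≡y (M'-edge p q e))

-- Assembling the isomorphism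

module Classification {D : Graph} (S : Setting D) (ends : InfinitelyManyEnds D) where
  open Twins S

  private
    ray : Ray D
    ray = proj₁ (ends 1) zero

  twins-differ : ∀ x → twin true x ≢ twin false x
  twins-differ x eq = Parallel.contradiction S ends parallel
    where
    parallel : ∀ y → twin true y ≡ twin false y
    parallel y with transitive homogeneous loopless x y
    ... | g , refl = trans (sym (⟦⟧-twin g true x)) (trans (cong ⟦ g ⟧ eq) (⟦⟧-twin g false x))

  no-triangle : ∀ d {x y z} → Dir D d x y → Dir D d y z → ¬ Dir D d z x
  no-triangle = NoTriangles.no-triangle S (proj₁ (proj₂ ray)) twins-differ

  open Acyclicity S twins-differ no-triangle
  open Labelling S twins-differ no-triangle

  -- Period one means τ⁻τ⁺ fixes a vertex, so that its two twins coincide.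
  least-period≥1 : ∀ {n} → LeastPeriod n base → 1 ≤ n
  least-period≥1 {zero} (fixed , _) = ⊥-elim (twins-differ base
    (trans (sym (twin-involutive false _)) (cong (twin false) fixed)))
  least-period≥1 {suc n} _ = s≤s z≤n

  iso-M' : (∀ v x y → x ≢ v → y ≢ v → Star (λ a b → UAdj D a b × a ≢ v × b ≢ v) x y) →
    Σ ℕ λ m → 2 ≤ m × Iso D (M' m)
  iso-M' no-cut-vertex =
    let k , fixed = periodic base (no-cut-vertex base (twin true base) (twin false base) (twin≢ true base) (twin≢ false base))
        n , least = least-period k base fixed
    in suc n , s≤s (least-period≥1 least) , iso n (least-period-everywhere least)

theorem7p4 : (D : Graph) → IsDigraph D → Connected D →
    CHom (V D) (E D) → ¬ CHom (V D) (UAdj D) →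
    InfinitelyManyEnds D → DeltaK22 D → ConnectivityGT1 D →
    Σ ℕ λ m → 2 ≤ m × Iso D (M' m)
theorem7p4 D (base , loopless , asymmetric) connected homogeneous _ ends delta (_ , _ , no-cut-vertex) =
  Classification.iso-M' setting ends no-cut-vertex
  where
  twins : ∀ {x y} → UAdj D x y → TwinStructure D
  twins (inj₁ e) = FromDelta.twinStructure D homogeneous loopless delta e
  twins (inj₂ e) = FromDelta.twinStructure D homogeneous loopless delta e
  setting : Setting D
  setting = record
    { loopless = loopless ; asymmetric = asymmetric ; connected = connected ; homogeneous = homogeneous
    -- The edge from which the twins are built is the first edge of a ray.
    ; base = base ; twins = twins (proj₂ (proj₂ (proj₁ (ends 1) zero)) 0) }
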